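{- For every $n,w\in\mathbb{N}$ and every $0<\varepsilon\le 1$, the expander-based INW generator for length $n$ instantiated with $\lambda$-expanders for $\lambda=\frac{\varepsilon}{32w^3}$ is an $\varepsilon$-PRG for width-$w$ length-$n$ permutation read-once branching programs (that is, it $\varepsilon$-fools them). Its seed length is $O(\log(1/\lambda)\cdot\log n)=O\big((\log(1/\varepsilon)+\log w)\cdot\log n\big)$, where the implied constants are absolute (the first bound being understood for $n\ge 2$, and the second for $n,w\ge 2$).
   Context: **Permutation branching programs.** A width-$w$ length-$n$ read-once branching program $P$ is a layered directed graph with layers $V_0,\dots,V_n$, each identified with $[w]=\{1,\dots,w\}$; each vertex of $V_{t-1}$ ($t\in[n]$) has two outgoing edges to $V_t$ (possibly parallel), labelled $0$ and $1$. There is a start vertex $s\in V_0$ and a set of accept states $A\subseteq V_n$. For $t\in[n]$, $b\in\{0,1\}$, let $P_{t,b}\in\{0,1\}^{w\times w}$ be the matrix whose $(i,j)$ entry is $1$ iff the edge labelled $b$ from the $i$-th vertex of $V_{t-1}$ goes to the $j$-th vertex of $V_t$. $P$ is a permutation branching program if every $P_{t,b}$ is a permutation matrix. On input $x\in\{0,1\}^n$ the value is $P(x)=e_s^\top P_{1,x_1}P_{2,x_2}\cdots P_{n,x_n}\mathbf{1}_A\in\{0,1\}$, where $e_s$ is a standard basis vector and $\mathbf{1}_A$ is the indicator vector of $A$. **PRG.** $G:\{0,1\}^r\to\{0,1\}^n$ is an $\varepsilon$-PRG for width-$w$ length-$n$ permutation branching programs (it $\varepsilon$-fools them), with seed length $r$,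 if for every such program $P$, $\left|\mathbb{E}_{x\in\{0,1\}^n}[P(x)]-\mathbb{E}_{y\in\{0,1\}^r}[P(G(y))]\right|\le\varepsilon$, with $x,y$ uniform. **Expanders.** An undirected $D$-regular graph (self-loops and parallel edges allowed) on $N$ vertices with adjacency matrix $M$ is a $\lambda$-expander if the spectral norm of $\frac1D M-J$ is at most $\lambda$, where $J$ is the $N\times N$ matrix with all entries $1/N$. For a vertex $x$ and $y\in[D]$, $H(x,y)$ denotes the $y$-th neighbor of $x$ in the graph $H$. Known fact used for instantiation: for every $N\in\mathbb{N}$ and $\lambda>0$ there is an explicit $D$-regular $\lambda$-expander on $N$ vertices with $D=(1/\lambda)^{\Theta(1)}$, whose neighbor function is computable in space $O(\log(ND))$. **The INW generator.** Let $h=\lceil\log_2 n\rceil$. Take $d=\Theta(\log(1/\lambda))$ and, for $i=1,\dots,h$, let $H_i$ be a $2^d$-regular $\lambda$-expander on the vertex set $\{0,1\}^{(i-1)d+1}$ from the explicit family above (neighbor labels are identified with $\{0,1\}^d$). Define $G_i:\{0,1\}^{id+1}\to\{0,1\}^{2^i}$ recursively: $G_0(x)=x$ for $x\in\{0,1\}$, and for $i\ge1$, $x\in\{0,1\}^{(i-1)d+1}$, $y\in\{0,1\}^d$, $$G_i(x,y)=\big(G_{i-1}(x),\,G_{i-1}(H_i(x,y))\big).$$ The INW generator for length $n$ outputs the first $n$ bits of $G_h$ (equivalently, a program whose length is not a power of two is padded with identity layers to length $2^h$). Its seed length is $hd+1$. -}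

module Defs where

open import Data.Bool using (Bool; true; false; if_then_else_)
open import Data.Fin using (Fin; zero; suc)
open import Data.Fin.Permutation using (Permutation′; _⟨$⟩ʳ_)
import Data.Fin.Properties as Fin
open import Data.Fin.Subset using (Subset)
open import Data.Integer using (+_)
open import Data.Nat as ℕ using (ℕ; zero; suc; s≤s; z≤n)
open import Data.Nat.Induction using (<-rec)
open import Data.Nat.Logarithm using (⌈log₂_⌉; ⌈log₂⌈n/2⌉⌉≡⌈log₂n⌉∸1)
import Data.Nat.Properties as ℕ
open import Data.Product using (∃-syntax; _×_; _,_; proj₁; proj₂)
open import Data.Rational
  using (ℚ; 0ℚ; 1ℚ; ½; _+_; _*_; _-_; -_; _≤_; _<_; ∣_∣; 1/_; _/_; NonZero; Positive; positive)
import Data.Rational.Properties as ℚ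
open import Data.Rational.Solver using (module +-*-Solver)
open import Data.Vec using (Vec; []; _∷_; _++_; lookup; take; drop; truncate)
import Data.Vec.Properties as Vec
import Data.Bool.Properties as Bool
open import Function using (_∘_; _⇔_)
open import Relation.Binary.PropositionalEquality
  using (_≡_; refl; sym; trans; cong; subst)
open import Relation.Nullary.Decidable using (does)

open import Algebra.Properties.CommutativeMonoid.Sum ℚ.+-0-commutativeMonoid using (sum)

Cauchy : (ℕ → ℚ) → Set
Cauchy f = ∀ δ → 0ℚ < δ →
  ∃[ N ] ∀ m k → N ℕ.≤ m → N ℕ.≤ k → ∣ f m - f k ∣ < δ

record ℝ : Set where
  constructor mkℝ
  field
    seq    : ℕ → ℚ
    cauchy : Cauchy seq

open ℝ public

infix  4 _≤ᴿ_ _<ᴿ_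
infixl 6 _+ᴿ_
infixl 7 _*ᴿ_
infix  8 -ᴿ_
infixr 8 _^ᴿ_

_≤ᴿ_ : ℝ → ℝ → Set
x ≤ᴿ y = ∀ δ → 0ℚ < δ → ∃[ N ] ∀ k → N ℕ.≤ k → seq x k ≤ seq y k + δ

_<ᴿ_ : ℝ → ℝ → Set
x <ᴿ y = ∃[ δ ] 0ℚ < δ × (∃[ N ] ∀ k → N ℕ.≤ k → seq x k + δ ≤ seq y k)

fromℚ : ℚ → ℝ
fromℚ q .seq _ = q
fromℚ q .cauchy δ 0<δ =
  0 , λ _ _ _ _ → subst (λ z → ∣ z ∣ < δ) (sym (ℚ.+-inverseʳ q)) 0<δ

fromℕ : ℕ → ℝ
fromℕ n = fromℚ (+ n / 1)

0ᴿ 1ᴿ : ℝ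
0ᴿ = fromℚ 0ℚ
1ᴿ = fromℚ 1ℚ

private
  half-pos : ∀ δ → 0ℚ < δ → 0ℚ < ½ * δ
  half-pos δ 0<δ = ℚ.positive⁻¹ (½ * δ) {{ℚ.pos*pos⇒pos ½ δ {{positive 0<δ}}}}

  halves : ∀ δ → ½ * δ + ½ * δ ≡ δ
  halves δ = trans (sym (ℚ.*-distribʳ-+ δ ½ ½)) (ℚ.*-identityˡ δ)

  add-diff : ∀ a b c d → (a + b) - (c + d) ≡ (a - c) + (b - d)
  add-diff = solve 4 (λ a b c d → (a :+ b) :- (c :+ d) := (a :- c) :+ (b :- d)) refl
    where open +-*-Solver

  neg-diff : ∀ a b → - (a - b) ≡ - a - (- b)
  neg-diff = solve 2 (λ a b → :- (a :- b) := :- a :- (:- b)) refl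
    where open +-*-Solver

  mul-diff : ∀ a b c d → a * b - c * d ≡ a * (b - d) + d * (a - c)
  mul-diff = solve 4 (λ a b c d → a :* b :- c :* d := a :* (b :- d) :+ d :* (a :- c)) refl
    where open +-*-Solver

  cancel-mid : ∀ a b → a ≡ (a - b) + b
  cancel-mid = solve 2 (λ a b → a := (a :- b) :+ b) refl
    where open +-*-Solver

  sum-small : ∀ {a b} δ → ∣ a ∣ < ½ * δ → ∣ b ∣ < ½ * δ → ∣ a + b ∣ < δ
  sum-small {a} {b} δ p q = ℚ.≤-<-trans (ℚ.∣p+q∣≤∣p∣+∣q∣ a b)
    (subst (∣ a ∣ + ∣ b ∣ <_) (halves δ) (ℚ.+-mono-< p q))

  bounded : ∀ {f} → Cauchy f → ∃[ B ] 0ℚ < B × (∃[ N ] ∀ m → N ℕ.≤ m → ∣ f m ∣ < B)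
  bounded {f} cf = 1ℚ + ∣ f N ∣
    , ℚ.<-≤-trans (ℚ.positive⁻¹ 1ℚ)
        (ℚ.≤-trans (ℚ.≤-reflexive (sym (ℚ.+-identityʳ 1ℚ)))
                   (ℚ.+-monoʳ-≤ 1ℚ (ℚ.0≤∣p∣ (f N))))
    , N
    , λ m N≤m → subst (λ z → ∣ z ∣ < 1ℚ + ∣ f N ∣) (sym (cancel-mid (f m) (f N)))
        (ℚ.≤-<-trans (ℚ.∣p+q∣≤∣p∣+∣q∣ (f m - f N) (f N))
          (ℚ.+-monoˡ-< ∣ f N ∣ (proj₂ (cf 1ℚ (ℚ.positive⁻¹ 1ℚ)) m N N≤m ℕ.≤-refl)))
    where
    N = proj₁ (cf 1ℚ (ℚ.positive⁻¹ 1ℚ))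

  tolerance : ∀ B → 0ℚ < B → ∀ δ → 0ℚ < δ →
    ∃[ γ ] 0ℚ < γ × (∀ a b → ∣ a ∣ < B → ∣ b ∣ < γ → ∣ a * b ∣ < ½ * δ)
  tolerance B 0<B δ 0<δ = γ , 0<γ , small
    where
    instance
      B+ : Positive B
      B+ = positive 0<B
      B≠0 : NonZero B
      B≠0 = ℚ.pos⇒nonZero B
      B≥0 = ℚ.pos⇒nonNeg B
    γ = 1/ B * (½ * δ)
    0<γ : 0ℚ < γ
    0<γ = ℚ.positive⁻¹ γ
      {{ℚ.pos*pos⇒pos (1/ B) {{ℚ.1/pos⇒pos B}} (½ * δ) {{positive (half-pos δ 0<δ)}}}}
    Bγ : B * γ ≡ ½ * δ
    Bγ = trans (sym (ℚ.*-assoc B (1/ B) (½ * δ)))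
         (trans (cong (_* (½ * δ)) (ℚ.*-inverseʳ B)) (ℚ.*-identityˡ (½ * δ)))
    small : ∀ a b → ∣ a ∣ < B → ∣ b ∣ < γ → ∣ a * b ∣ < ½ * δ
    small a b a<B b<γ = subst (_< ½ * δ) (sym (ℚ.∣p*q∣≡∣p∣*∣q∣ a b))
      (ℚ.≤-<-trans (ℚ.*-monoʳ-≤-nonNeg ∣ b ∣ {{ℚ.∣-∣-nonNeg b}} (ℚ.<⇒≤ a<B))
        (subst (B * ∣ b ∣ <_) Bγ (ℚ.*-monoʳ-<-pos B b<γ)))

  +-cauchy : ∀ {f g} → Cauchy f → Cauchy g → Cauchy (λ k → f k + g k)
  +-cauchy {f} {g} cf cg δ 0<δ = M ℕ.⊔ N , λ m k m≥ k≥ →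
    subst (λ z → ∣ z ∣ < δ) (sym (add-diff (f m) (g m) (f k) (g k)))
      (sum-small δ (proj₂ F m k (ℕ.m⊔n≤o⇒m≤o M N m≥) (ℕ.m⊔n≤o⇒m≤o M N k≥))
                   (proj₂ G m k (ℕ.m⊔n≤o⇒n≤o M N m≥) (ℕ.m⊔n≤o⇒n≤o M N k≥)))
    where
    F = cf (½ * δ) (half-pos δ 0<δ)
    G = cg (½ * δ) (half-pos δ 0<δ)
    M = proj₁ F
    N = proj₁ G

  neg-cauchy : ∀ {f} → Cauchy f → Cauchy (λ k → - f k)
  neg-cauchy {f} cf δ 0<δ = proj₁ F , λ m k m≥ k≥ →
    subst (_< δ) (trans (sym (ℚ.∣-p∣≡∣p∣ (f m - f k))) (cong ∣_∣ (neg-diff (f m) (f k))))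
      (proj₂ F m k m≥ k≥)
    where
    F = cf δ 0<δ

  *-cauchy : ∀ {f g} → Cauchy f → Cauchy g → Cauchy (λ k → f k * g k)
  *-cauchy {f} {g} cf cg δ 0<δ = go (bounded {f} cf) (bounded {g} cg)
    where
    Bound : (ℕ → ℚ) → Set
    Bound h = ∃[ B ] 0ℚ < B × (∃[ N ] ∀ m → N ℕ.≤ m → ∣ h m ∣ < B)
    go : Bound f → Bound g →
         ∃[ N ] ∀ m k → N ℕ.≤ m → N ℕ.≤ k → ∣ f m * g m - f k * g k ∣ < δ
    go (B , 0<B , M , f<B) (C , 0<C , N , g<C) =
      (M ℕ.⊔ N) ℕ.⊔ (M′ ℕ.⊔ N′) , λ m k m≥ k≥ →
        subst (λ z → ∣ z ∣ < δ) (sym (mul-diff (f m) (g m) (f k) (g k)))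
          (sum-small δ
            (proj₂ (proj₂ β) (f m) (g m - g k) (f<B m (ℕ.m⊔n≤o⇒m≤o M N (l m≥)))
              (proj₂ G m k (ℕ.m⊔n≤o⇒m≤o M′ N′ (r m≥)) (ℕ.m⊔n≤o⇒m≤o M′ N′ (r k≥))))
            (proj₂ (proj₂ γ) (g k) (f m - f k) (g<C k (ℕ.m⊔n≤o⇒n≤o M N (l k≥)))
              (proj₂ F m k (ℕ.m⊔n≤o⇒n≤o M′ N′ (r m≥)) (ℕ.m⊔n≤o⇒n≤o M′ N′ (r k≥)))))
      where
      β = tolerance B 0<B δ 0<δ
      γ = tolerance C 0<C δ 0<δ
      G = cg (proj₁ β) (proj₁ (proj₂ β))
      F = cf (proj₁ γ) (proj₁ (proj₂ γ))
      M′ = proj₁ G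
      N′ = proj₁ F
      l : ∀ {j} → (M ℕ.⊔ N) ℕ.⊔ (M′ ℕ.⊔ N′) ℕ.≤ j → M ℕ.⊔ N ℕ.≤ j
      l = ℕ.m⊔n≤o⇒m≤o (M ℕ.⊔ N) (M′ ℕ.⊔ N′)
      r : ∀ {j} → (M ℕ.⊔ N) ℕ.⊔ (M′ ℕ.⊔ N′) ℕ.≤ j → M′ ℕ.⊔ N′ ℕ.≤ j
      r = ℕ.m⊔n≤o⇒n≤o (M ℕ.⊔ N) (M′ ℕ.⊔ N′)

_+ᴿ_ : ℝ → ℝ → ℝ
x +ᴿ y = mkℝ (λ k → seq x k + seq y k) (+-cauchy {seq x} {seq y} (cauchy x) (cauchy y))

-ᴿ_ : ℝ → ℝ
-ᴿ x = mkℝ (λ k → - seq x k) (neg-cauchy {seq x} (cauchy x))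

_*ᴿ_ : ℝ → ℝ → ℝ
x *ᴿ y = mkℝ (λ k → seq x k * seq y k) (*-cauchy {seq x} {seq y} (cauchy x) (cauchy y))

_^ᴿ_ : ℝ → ℕ → ℝ
x ^ᴿ zero  = 1ᴿ
x ^ᴿ suc q = x *ᴿ x ^ᴿ q

-- ℓ = log₂ x: a rational (a - b)/q lies below (above) ℓ exactly when
-- 2^((a - b)/q) lies below (above) x.
IsLog₂ : ℝ → ℝ → Set
IsLog₂ x ℓ = ∀ (a b q : ℕ) →
    (fromℕ (2 ℕ.^ a) ≤ᴿ fromℕ (2 ℕ.^ b) *ᴿ x ^ᴿ q ⇔ fromℕ a ≤ᴿ fromℕ b +ᴿ fromℕ q *ᴿ ℓ)
  × (fromℕ (2 ℕ.^ b) *ᴿ x ^ᴿ q ≤ᴿ fromℕ (2 ℕ.^ a) ⇔ fromℕ b +ᴿ fromℕ q *ᴿ ℓ ≤ᴿ fromℕ a)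

-- log₂ (1/x) = - log₂ x
IsLog₂[1/_] : ℝ → ℝ → Set
IsLog₂[1/ x ] ℓ = IsLog₂ x (-ᴿ ℓ)

Bits : ℕ → Set
Bits = Vec Bool

∑ᵇ : {A : Set} → (A → A → A) → ∀ m → (Bits m → A) → A
∑ᵇ _⊕_ zero    f = f []
∑ᵇ _⊕_ (suc m) f = ∑ᵇ _⊕_ m (f ∘ (false ∷_)) ⊕ ∑ᵇ _⊕_ m (f ∘ (true ∷_))

1/2^_ : ℕ → ℚ
1/2^ m = _/_ (+ 1) (2 ℕ.^ m) {{ℕ.m^n≢0 2 m}}

𝔼 : ∀ m → (Bits m → ℚ) → ℚ
𝔼 m f = 1/2^ m * ∑ᵇ _+_ m f

𝟙 : Bool → ℚ
𝟙 b = if b then 1ℚ else 0ℚ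

record BranchingProgram (w n : ℕ) : Set where
  field
    edge   : Fin n → Bool → Fin w → Fin w
    start  : Fin w
    accept : Subset w

SqMatrix : ℕ → Set
SqMatrix w = Fin w → Fin w → ℚ

module _ {w n : ℕ} (P : BranchingProgram w n) where
  open BranchingProgram P

  edgeMatrix : Fin n → Bool → SqMatrix w
  edgeMatrix t b i j = 𝟙 (does (edge t b i Fin.≟ j))

IsPermutationMatrix : ∀ {w} → SqMatrix w → Set
IsPermutationMatrix {w} M =
  ∃[ π ] ∀ (i j : Fin w) → M i j ≡ 𝟙 (does ((π ⟨$⟩ʳ i) Fin.≟ j))

IsPermutationProgram : ∀ {w n} → BranchingProgram w n → Set
IsPermutationProgram P = ∀ t b → IsPermutationMatrix (edgeMatrix P t b)

-- v ᵀ M₁[x₁] M₂[x₂] ⋯ Mₙ[xₙ]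
_·∏_[_] : ∀ {w n} → (Fin w → ℚ) → (Fin n → Bool → SqMatrix w) → Bits n → (Fin w → ℚ)
v ·∏ M [ [] ]    = v
v ·∏ M [ b ∷ x ] = (λ j → sum (λ i → v i * M zero b i j)) ·∏ M ∘ suc [ x ]

value : ∀ {w n} → BranchingProgram w n → Bits n → ℚ
value P x = sum (λ j → (e ·∏ edgeMatrix P [ x ]) j * 𝟙 (lookup accept j))
  where
  open BranchingProgram P
  e = λ i → 𝟙 (does (start Fin.≟ i))

IsPRG : ℝ → ∀ w n r → (Bits r → Bits n) → Set
IsPRG ε w n r G = (P : BranchingProgram w n) → IsPermutationProgram P →
  fromℚ ∣ 𝔼 n (value P) - 𝔼 r (value P ∘ G) ∣ ≤ᴿ ε

BitMatrix : ℕ → Set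
BitMatrix m = Bits m → Bits m → ℚ

neighborCount : ∀ {m d} → (Bits m → Bits d → Bits m) → BitMatrix m
neighborCount {m} {d} H x y = ∑ᵇ _+_ d (λ e → 𝟙 (does (Vec.≡-dec Bool._≟_ (H x e) y)))

-- Vertices {0,1}^m and degree 2^d, with edge labels in {0,1}^d.  Parallel edges and
-- self-loops are allowed (a loop counts once per label); being undirected means that
-- the adjacency matrix is symmetric.
record RegularGraph (m d : ℕ) : Set where
  field
    neighbor   : Bits m → Bits d → Bits m
    undirected : ∀ x y → neighborCount neighbor x y ≡ neighborCount neighbor y x

  adjacency : BitMatrix m
  adjacency = neighborCount neighbor

open RegularGraph public

-- ‖A v‖ ≤ s ‖v‖ for all v, with both (nonnegative) sides squared
SpectralNorm≤ : ∀ {m} → BitMatrix m → ℝ → Set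
SpectralNorm≤ {m} A s = 0ᴿ ≤ᴿ s ×
  ∀ (v : Bits m → ℝ) →
    ∑ᵇ _+ᴿ_ m (λ x → ∑ᵇ _+ᴿ_ m (λ y → fromℚ (A x y) *ᴿ v y) ^ᴿ 2)
      ≤ᴿ s ^ᴿ 2 *ᴿ ∑ᵇ _+ᴿ_ m (λ x → v x ^ᴿ 2)

IsExpander : ∀ {m d} → ℝ → RegularGraph m d → Set
IsExpander {m} {d} s H = SpectralNorm≤ (λ x y → 1/2^ d * adjacency H x y - 1/2^ m) s

seedLength : ℕ → ℕ → ℕ
seedLength d zero    = 1
seedLength d (suc i) = seedLength d i ℕ.+ d

seedLength-closed : ∀ d h → seedLength d h ≡ h ℕ.* d ℕ.+ 1
seedLength-closed d zero    = refl
seedLength-closed d (suc h) =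
  trans (ℕ.+-comm (seedLength d h) d)
    (trans (cong (d ℕ.+_) (seedLength-closed d h)) (sym (ℕ.+-assoc d (h ℕ.* d) 1)))

-- `H i` is the graph used to pass from `gen i` to `gen (suc i)`; the trailing `[]`
-- makes the length 2 ^ suc i = 2 ^ i + (2 ^ i + 0) hold by computation.
gen : ∀ {d} → (∀ i → RegularGraph (seedLength d i) d) → ∀ i → Bits (seedLength d i) → Bits (2 ℕ.^ i)
gen H zero s = s
gen {d} H (suc i) s = gen H i x ++ gen H i (neighbor (H i) x y) ++ []
  where
  x = take (seedLength d i) s
  y = drop (seedLength d i) s

n≤2^⌈log₂n⌉ : ∀ n → n ℕ.≤ 2 ℕ.^ ⌈log₂ n ⌉
n≤2^⌈log₂n⌉ = <-rec _ step
  where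
  step : ∀ n → (∀ {m} → m ℕ.< n → m ℕ.≤ 2 ℕ.^ ⌈log₂ m ⌉) → n ℕ.≤ 2 ℕ.^ ⌈log₂ n ⌉
  step 0 _ = z≤n
  step 1 _ = s≤s z≤n
  step n@(suc (suc m)) ih = ℕ.≤-trans n≤2k (ℕ.*-monoʳ-≤ 2 k≤)
    where
    k = ℕ.⌈ n /2⌉
    k≤ : k ℕ.≤ 2 ℕ.^ (⌈log₂ n ⌉ ℕ.∸ 1)
    k≤ = subst (λ e → k ℕ.≤ 2 ℕ.^ e) (⌈log₂⌈n/2⌉⌉≡⌈log₂n⌉∸1 n) (ih (ℕ.⌈n/2⌉<n m))
    n≤2k : n ℕ.≤ 2 ℕ.* k
    n≤2k = ℕ.≤-trans (ℕ.≤-reflexive (sym (ℕ.⌊n/2⌋+⌈n/2⌉≡n n)))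
      (ℕ.+-mono-≤ (ℕ.⌊n/2⌋≤⌈n/2⌉ n) (ℕ.≤-reflexive (sym (ℕ.+-identityʳ k))))

INW : ∀ {d} n → (∀ i → RegularGraph (seedLength d i) d) →
      Bits (seedLength d ⌈log₂ n ⌉) → Bits n
INW n H s = truncate (n≤2^⌈log₂n⌉ n) (gen H ⌈log₂ n ⌉ s)

inwλ : ℝ → ∀ w → .{{ℕ.NonZero w}} → ℝ
inwλ ε w = ε *ᴿ fromℚ (_/_ (+ 1) (32 ℕ.* w ℕ.^ 3) {{ℕ.m*n≢0 32 (w ℕ.^ 3) {{_}} {{ℕ.m^n≢0 w 3}}}})

{-# OPTIONS --safe #-}
-- For a stretch of layers let rowVar u (colVar z) be the sum over its layers of
-- ½ ‖v π₀ - v π₁‖₁, where π₀, π₁ are the two permutations of the layer and v is the uniform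
-- average of u (of z) carried through the layers before (after) it.  Averaging two permuted
-- copies of v lowers the potential Σᵢⱼ |vᵢ - vⱼ| by at least that summand, so rowVar and
-- colVar are bounded by the initial potential however many layers there are.
--
-- By induction on i the error of Gᵢ on a stretch is at most 2 λ · rowVar · colVar.  When two
-- halves with values a₁, a₂ of rowVar and b₁, b₂ of colVar are joined, their own errors
-- contribute 2 λ a₁ b₁ + 2 λ a₂ b₂; the expander contributes λ a₁ b₂, because for every seed
-- the two vectors it correlates lie within a₁ and b₂ of fixed ones; and the product of the two
-- errors is at most 16 λ² w³ a₁ b₂ ≤ λ a₁ b₂.  The total is at most 2 λ (a₁ + a₂)(b₁ + b₂),
-- so nothing is lost per level of the recursion.

module Submission where

open import Defs
open import Algebra.Bundles using (CommutativeRing)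
open import Data.Bool using (Bool; true; false)
import Data.Bool.Properties as Bool
open import Data.Empty using (⊥)
open import Data.Fin using (Fin; zero; suc)
open import Data.Fin.Permutation using (Permutation′; _⟨$⟩ʳ_; _⟨$⟩ˡ_; flip; inverseˡ) renaming (id to idₚ)
import Data.Fin.Properties as Fin
import Data.Integer as ℤ
import Data.Integer.Properties as ℤ
open import Data.Nat as ℕ using (ℕ; zero; suc)
open import Data.Nat.Logarithm using (⌈log₂_⌉; ⌈log₂⌉-mono-≤; ⌈log₂2^n⌉≡n)
import Data.Nat.Properties as ℕ
open import Data.Product using (∃-syntax; _×_; _,_; proj₁; proj₂)
open import Data.Rational as ℚ
  using (ℚ; mkℚ; 0ℚ; 1ℚ; ½; _+_; _*_; _-_; -_; ∣_∣; _/_; toℚᵘ; positive; nonNegative)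
import Data.Rational.Properties as ℚ
open import Algebra.Properties.Semiring.Sum (CommutativeRing.semiring ℚ.+-*-commutativeRing)
  using (sum; sum-cong-≗; ∑-distrib-+; sum-permute; *-distribˡ-sum)
open import Data.Rational.Unnormalised as ℚᵘ using (mkℚᵘ)
import Data.Rational.Unnormalised.Properties as ℚᵘ
open import Data.Sum using (inj₁; inj₂)
open import Data.Vec
  using (Vec; []; _∷_; _++_; take; drop; truncate; replicate; padRight; splitAt; tabulate; lookup)
import Data.Vec.Properties as Vec
open import Function using (_∘_)
open import Function.Bundles using (Equivalence)
open import Level using (0ℓ)
open import Relation.Binary.Definitions using (tri<; tri≈; tri>)
open import Relation.Binary.PropositionalEquality
  using (_≡_; refl; sym; trans; cong; cong₂; subst; subst₂; module ≡-Reasoning)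
open import Relation.Nullary.Decidable using (does; yes; no; dec⇒maybe)
open import Relation.Nullary.Negation using (contradiction)
open import Tactic.RingSolver using (solve-∀)
open import Tactic.RingSolver.Core.AlmostCommutativeRing using (AlmostCommutativeRing; fromCommutativeRing)

-- The estimates run over `ℚ`, because ε and λ are Cauchy sequences whose order cannot be decided: a
-- rational `L` slightly above λ takes its place, and the constants leave room for that.
--
-- Permutations enter twice. They preserve ℓ¹ distances, so a deviation created in one layer is not
-- stretched by the others; and the transpose of a permutation matrix is its inverse, so rows and
-- columns evolve by the same kind of map and share one potential.
--
-- The 16 w³ arises because the mean error of a half is a vector that is controlled only entry by
-- entry, by pairing it with basis vectors. These have potential at most 2w, so an entry is at most
-- 4 λ w a₁ on the left and 4 λ w b₂ on the right, and w products of such entries are summed. For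
-- the whole program the start vector has potential at most 2w and the accept vector at most w², so
-- the final error is about 4 λ w³ = ε/8.

module _ where

  open import Data.Rational using (_≤_; _<_)

  -- Ordered-field arithmetic on the rationals

  ℚ-ring : AlmostCommutativeRing 0ℓ 0ℓ
  ℚ-ring = fromCommutativeRing ℚ.+-*-commutativeRing (λ x → dec⇒maybe (0ℚ ℚ.≟ x))

  -- An inequality by certificate: the slack `r` is exhibited, the identity is left to the ring
  -- solver, and only the sign of `r` remains to be checked.
  ≤-by : ∀ {p q} r → q ≡ p + r → 0ℚ ≤ r → p ≤ q
  ≤-by {p} r refl 0≤r = subst (_≤ p + r) (ℚ.+-identityʳ p) (ℚ.+-monoʳ-≤ p 0≤r)

  0≤q-p : ∀ {p q} → p ≤ q → 0ℚ ≤ q - p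
  0≤q-p {p} {q} p≤q = subst (_≤ q - p) (ℚ.+-inverseʳ p) (ℚ.+-monoˡ-≤ (- p) p≤q)

  +-nonneg : ∀ {p q} → 0ℚ ≤ p → 0ℚ ≤ q → 0ℚ ≤ p + q
  +-nonneg = ℚ.+-mono-≤

  *-nonneg : ∀ {p q} → 0ℚ ≤ p → 0ℚ ≤ q → 0ℚ ≤ p * q
  *-nonneg {p} {q} 0≤p 0≤q = ℚ.nonNegative⁻¹ (p * q)
    {{ℚ.nonNeg*nonNeg⇒nonNeg p {{nonNegative 0≤p}} q {{nonNegative 0≤q}}}}

  *-monoˡ : ∀ {r p q} → 0ℚ ≤ r → p ≤ q → r * p ≤ r * q
  *-monoˡ {r} 0≤r = ℚ.*-monoˡ-≤-nonNeg r {{nonNegative 0≤r}}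

  *-monoʳ : ∀ {r p q} → 0ℚ ≤ r → p ≤ q → p * r ≤ q * r
  *-monoʳ {r} 0≤r = ℚ.*-monoʳ-≤-nonNeg r {{nonNegative 0≤r}}

  *-mono : ∀ {p q r s} → 0ℚ ≤ r → 0ℚ ≤ q → p ≤ q → r ≤ s → p * r ≤ q * s
  *-mono 0≤r 0≤q p≤q r≤s = ℚ.≤-trans (*-monoʳ 0≤r p≤q) (*-monoˡ 0≤q r≤s)

  0≤½ : 0ℚ ≤ ½
  0≤½ = ℚ.nonNegative⁻¹ ½

  square-nonneg : ∀ p → 0ℚ ≤ p * p
  square-nonneg p with ℚ.≤-total 0ℚ p
  ... | inj₁ 0≤p = *-nonneg 0≤p 0≤p
  ... | inj₂ p≤0 = subst (0ℚ ≤_) (lemma p) (*-nonneg 0≤-p 0≤-p)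
    where
    0≤-p = ℚ.neg-antimono-≤ p≤0
    lemma : ∀ p → (- p) * (- p) ≡ p * p
    lemma = solve-∀ ℚ-ring

  p≤∣p∣ : ∀ p → p ≤ ∣ p ∣
  p≤∣p∣ p with ℚ.≤-total 0ℚ p
  ... | inj₁ 0≤p = ℚ.≤-reflexive (sym (ℚ.0≤p⇒∣p∣≡p 0≤p))
  ... | inj₂ p≤0 = ℚ.≤-trans p≤0 (ℚ.0≤∣p∣ p)

  ∣p∣≤ : ∀ {p q} → p ≤ q → - p ≤ q → ∣ p ∣ ≤ q
  ∣p∣≤ {p} p≤q -p≤q with ℚ.∣p∣≡p∨∣p∣≡-p p
  ... | inj₁ eq = subst (_≤ _) (sym eq) p≤q
  ... | inj₂ eq = subst (_≤ _) (sym eq) -p≤q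

  ∣-∣-square : ∀ p → ∣ p ∣ * ∣ p ∣ ≡ p * p
  ∣-∣-square p = trans (sym (ℚ.∣p*q∣≡∣p∣*∣q∣ p p)) (ℚ.0≤p⇒∣p∣≡p (square-nonneg p))

  ∣-∣-swap : ∀ p q → ∣ p - q ∣ ≡ ∣ q - p ∣
  ∣-∣-swap p q = trans (sym (ℚ.∣-p∣≡∣p∣ (p - q))) (cong ∣_∣ (lemma p q))
    where
    lemma : ∀ p q → - (p - q) ≡ q - p
    lemma = solve-∀ ℚ-ring

  -- Stands in for a square root, which `ℚ` does not have: the spectral norm and Cauchy-Schwarz both
  -- come in squared form.
  square-cancel-≤ : ∀ {p q} → 0ℚ ≤ q → p * p ≤ q * q → p ≤ q
  square-cancel-≤ {p} {q} 0≤q pp≤qq with ℚ.≤-total p q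
  ... | inj₁ p≤q = p≤q
  ... | inj₂ q≤p with ℚ.<-cmp 0ℚ p
  ...   | tri< 0<p _ _ = ℚ.*-cancelˡ-≤-pos p {{positive 0<p}} (ℚ.≤-trans pp≤qq (*-monoʳ 0≤q q≤p))
  ...   | tri≈ _ refl _ = 0≤q
  ...   | tri> _ _ p<0 = ℚ.≤-trans (ℚ.<⇒≤ p<0) 0≤q

  -- Positive linear functionals

  -- Sums over `Fin n`, sums over bit strings, expectations and products of these all satisfy these
  -- laws, so monotonicity, the triangle inequality and Cauchy-Schwarz are proved once. `at-cong` is
  -- a field because functions are compared pointwise.
  record Functional (A : Set) : Set where
    field
      at       : (A → ℚ) → ℚ
      at-cong  : ∀ {f g} → (∀ x → f x ≡ g x) → at f ≡ at g
      at-+     : ∀ f g → at (λ x → f x + g x) ≡ at f + at g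
      at-*     : ∀ c f → at (λ x → c * f x) ≡ c * at f
      nonneg   : ∀ {f} → (∀ x → 0ℚ ≤ f x) → 0ℚ ≤ at f

    at-*ʳ : ∀ c f → at (λ x → f x * c) ≡ at f * c
    at-*ʳ c f = trans (at-cong (λ x → ℚ.*-comm (f x) c)) (trans (at-* c f) (ℚ.*-comm c (at f)))

    at-neg : ∀ f → at (λ x → - f x) ≡ - at f
    at-neg f = trans (at-cong (λ x → lemma (f x))) (trans (at-* (- 1ℚ) f) (sym (lemma (at f))))
      where
      lemma : ∀ p → - p ≡ - 1ℚ * p
      lemma = solve-∀ ℚ-ring

    at-∸ : ∀ f g → at (λ x → f x - g x) ≡ at f - at g
    at-∸ f g = trans (at-+ f (λ x → - g x)) (cong (at f +_) (at-neg g))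

    mono : ∀ {f g} → (∀ x → f x ≤ g x) → at f ≤ at g
    mono {f} {g} f≤g = ≤-by (at g - at f) (lemma (at g) (at f))
      (subst (0ℚ ≤_) (at-∸ g f) (nonneg (λ x → 0≤q-p (f≤g x))))
      where
      lemma : ∀ p q → p ≡ q + (p - q)
      lemma = solve-∀ ℚ-ring

    at-∣∣ : ∀ f → ∣ at f ∣ ≤ at (λ x → ∣ f x ∣)
    at-∣∣ f = ∣p∣≤ (mono (λ x → p≤∣p∣ (f x)))
      (subst (_≤ at (λ x → ∣ f x ∣)) (at-neg f)
        (mono (λ x → subst (- f x ≤_) (ℚ.∣-p∣≡∣p∣ (f x)) (p≤∣p∣ (- f x)))))

    -- 2 (at f² at h² - (at fh)²) is the value of at ⊗ at on (f(x) h(y) - f(y) h(x))².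
    cauchy-schwarz : ∀ (f h : A → ℚ) →
      at (λ x → f x * h x) * at (λ x → f x * h x) ≤ at (λ x → f x * f x) * at (λ x → h x * h x)
    cauchy-schwarz f h = ≤-by {S * S} {F * H} (½ * D) (split F H S) (*-nonneg 0≤½ (subst (0ℚ ≤_) D≡ 0≤double))
      where
      F = at (λ x → f x * f x)
      H = at (λ x → h x * h x)
      S = at (λ x → f x * h x)
      D = (F * H - (1ℚ + 1ℚ) * S * S) + H * F
      split : ∀ F H S → F * H ≡ S * S + ½ * ((F * H - (1ℚ + 1ℚ) * S * S) + H * F)
      split = solve-∀ ℚ-ring
      kernel : A → A → ℚ
      kernel x y = ((f x * f x) * (h y * h y) - (1ℚ + 1ℚ) * (f x * h x) * (f y * h y))
        + (h x * h x) * (f y * f y)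
      kernel≡ : ∀ a b c d →
        (a * d - c * b) * (a * d - c * b)
          ≡ ((a * a) * (d * d) - (1ℚ + 1ℚ) * (a * b) * (c * d)) + (b * b) * (c * c)
      kernel≡ = solve-∀ ℚ-ring
      at₃ : ∀ a b c (p q r : A → ℚ) →
        at (λ y → (a * p y - b * q y) + c * r y) ≡ (a * at p - b * at q) + c * at r
      at₃ a b c p q r = trans (at-+ (λ y → a * p y - b * q y) (λ y → c * r y))
        (cong₂ _+_ (trans (at-∸ (λ y → a * p y) (λ y → b * q y)) (cong₂ _-_ (at-* a p) (at-* b q)))
                   (at-* c r))
      0≤double : 0ℚ ≤ at (λ x → at (kernel x))
      0≤double = nonneg (λ x → nonneg (λ y →
        subst (0ℚ ≤_) (kernel≡ (f x) (h x) (f y) (h y)) (square-nonneg (f x * h y - f y * h x))))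
      rearrange : ∀ a b c F H S →
        (a * H - (1ℚ + 1ℚ) * c * S) + b * F ≡ (H * a - ((1ℚ + 1ℚ) * S) * c) + F * b
      rearrange = solve-∀ ℚ-ring
      finish : ∀ F H S → (H * F - ((1ℚ + 1ℚ) * S) * S) + F * H ≡ (F * H - (1ℚ + 1ℚ) * S * S) + H * F
      finish = solve-∀ ℚ-ring
      D≡ : at (λ x → at (kernel x)) ≡ D
      D≡ = trans (at-cong (λ x → trans
                    (at₃ (f x * f x) ((1ℚ + 1ℚ) * (f x * h x)) (h x * h x)
                      (λ y → h y * h y) (λ y → f y * h y) (λ y → f y * f y))
                    (rearrange (f x * f x) (h x * h x) (f x * h x) F H S)))
           (trans (at₃ H ((1ℚ + 1ℚ) * S) F (λ x → f x * f x) (λ x → f x * h x) (λ x → h x * h x))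
             (finish F H S))

  open Functional public

  ∑ꟳ : ∀ n → Functional (Fin n)
  ∑ꟳ n .at        = sum
  ∑ꟳ n .at-cong   = sum-cong-≗
  ∑ꟳ n .at-+      = ∑-distrib-+
  ∑ꟳ n .at-* c f  = sym (*-distribˡ-sum c f)
  ∑ꟳ zero    .nonneg 0≤f = ℚ.≤-refl
  ∑ꟳ (suc n) .nonneg 0≤f = +-nonneg (0≤f zero) (∑ꟳ n .nonneg (λ i → 0≤f (suc i)))

  ∑ᴮ : ∀ m → Functional (Bits m)
  ∑ᴮ m .at = ∑ᵇ _+_ m
  ∑ᴮ zero    .at-cong f≗g = f≗g []
  ∑ᴮ (suc m) .at-cong f≗g =
    cong₂ _+_ (∑ᴮ m .at-cong (f≗g ∘ (false ∷_))) (∑ᴮ m .at-cong (f≗g ∘ (true ∷_)))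
  ∑ᴮ zero    .at-+ f g = refl
  ∑ᴮ (suc m) .at-+ f g =
    trans (cong₂ _+_ (∑ᴮ m .at-+ (f ∘ (false ∷_)) (g ∘ (false ∷_)))
                     (∑ᴮ m .at-+ (f ∘ (true ∷_)) (g ∘ (true ∷_))))
          (lemma (∑ᵇ _+_ m (f ∘ (false ∷_))) (∑ᵇ _+_ m (g ∘ (false ∷_)))
                 (∑ᵇ _+_ m (f ∘ (true ∷_))) (∑ᵇ _+_ m (g ∘ (true ∷_))))
    where
    lemma : ∀ a b c d → (a + b) + (c + d) ≡ (a + c) + (b + d)
    lemma = solve-∀ ℚ-ring
  ∑ᴮ zero    .at-* c f = refl
  ∑ᴮ (suc m) .at-* c f =
    trans (cong₂ _+_ (∑ᴮ m .at-* c (f ∘ (false ∷_))) (∑ᴮ m .at-* c (f ∘ (true ∷_))))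
          (sym (ℚ.*-distribˡ-+ c (∑ᵇ _+_ m (f ∘ (false ∷_))) (∑ᵇ _+_ m (f ∘ (true ∷_)))))
  ∑ᴮ zero    .nonneg 0≤f = 0≤f []
  ∑ᴮ (suc m) .nonneg 0≤f =
    +-nonneg (∑ᴮ m .nonneg (0≤f ∘ (false ∷_))) (∑ᴮ m .nonneg (0≤f ∘ (true ∷_)))

  scaled : ∀ {A} c → 0ℚ ≤ c → Functional A → Functional A
  scaled c 0≤c Λ .at f        = c * at Λ f
  scaled c 0≤c Λ .at-cong f≗g = cong (c *_) (at-cong Λ f≗g)
  scaled c 0≤c Λ .at-+ f g    = trans (cong (c *_) (at-+ Λ f g)) (ℚ.*-distribˡ-+ c (at Λ f) (at Λ g))
  scaled c 0≤c Λ .at-* a f    = trans (cong (c *_) (at-* Λ a f)) (lemma c a (at Λ f))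
    where
    lemma : ∀ c a x → c * (a * x) ≡ a * (c * x)
    lemma = solve-∀ ℚ-ring
  scaled c 0≤c Λ .nonneg 0≤f  = *-nonneg 0≤c (nonneg Λ 0≤f)

  _⊗_ : ∀ {A B} → Functional A → Functional B → Functional (A × B)
  (Λ ⊗ M) .at f        = at Λ (λ x → at M (λ y → f (x , y)))
  (Λ ⊗ M) .at-cong f≗g = at-cong Λ (λ x → at-cong M (λ y → f≗g (x , y)))
  (Λ ⊗ M) .at-+ f g    = trans (at-cong Λ (λ x → at-+ M (λ y → f (x , y)) (λ y → g (x , y))))
    (at-+ Λ (λ x → at M (λ y → f (x , y))) (λ x → at M (λ y → g (x , y))))
  (Λ ⊗ M) .at-* c f    = trans (at-cong Λ (λ x → at-* M c (λ y → f (x , y))))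
    (at-* Λ c (λ x → at M (λ y → f (x , y))))
  (Λ ⊗ M) .nonneg 0≤f  = nonneg Λ (λ x → nonneg M (λ y → 0≤f (x , y)))

  at-0 : ∀ {A} (Λ : Functional A) → at Λ (λ _ → 0ℚ) ≡ 0ℚ
  at-0 Λ = trans (at-cong Λ {g = λ _ → 0ℚ * 0ℚ} (λ _ → refl)) (trans (at-* Λ 0ℚ (λ _ → 0ℚ)) (ℚ.*-zeroˡ (at Λ (λ _ → 0ℚ))))

  at-sum : ∀ {A n} (Λ : Functional A) (f : A → Fin n → ℚ) →
    at Λ (λ x → sum (f x)) ≡ sum (λ i → at Λ (λ x → f x i))
  at-sum {n = zero}  Λ f = at-0 Λ
  at-sum {n = suc n} Λ f = trans (at-+ Λ (λ x → f x zero) (λ x → sum (f x ∘ suc)))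
    (cong (at Λ (λ x → f x zero) +_) (at-sum Λ (λ x → f x ∘ suc)))

  at-∑ᵇ : ∀ {A} m (Λ : Functional A) (f : A → Bits m → ℚ) →
    at Λ (λ x → ∑ᵇ _+_ m (f x)) ≡ ∑ᵇ _+_ m (λ y → at Λ (λ x → f x y))
  at-∑ᵇ zero    Λ f = refl
  at-∑ᵇ (suc m) Λ f = trans (at-+ Λ (λ x → ∑ᵇ _+_ m (f x ∘ (false ∷_))) (λ x → ∑ᵇ _+_ m (f x ∘ (true ∷_))))
    (cong₂ _+_ (at-∑ᵇ m Λ (λ x → f x ∘ (false ∷_))) (at-∑ᵇ m Λ (λ x → f x ∘ (true ∷_))))

  sum-δ : ∀ {n} (f : Fin n → ℚ) i → sum (λ j → 𝟙 (does (i Fin.≟ j)) * f j) ≡ f i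
  sum-δ {suc n} f zero    = trans
    (cong₂ _+_ (ℚ.*-identityˡ (f zero))
      (trans (∑ꟳ n .at-cong (λ j → ℚ.*-zeroˡ (f (suc j)))) (at-0 (∑ꟳ n))))
    (ℚ.+-identityʳ (f zero))
  sum-δ {suc n} f (suc i) = trans
    (cong₂ _+_ (ℚ.*-zeroˡ (f zero)) (sum-δ (f ∘ suc) i))
    (ℚ.+-identityˡ (f (suc i)))

  δ-comm : ∀ {n} (i j : Fin n) → 𝟙 (does (i Fin.≟ j)) ≡ 𝟙 (does (j Fin.≟ i))
  δ-comm zero    zero    = refl
  δ-comm zero    (suc j) = refl
  δ-comm (suc i) zero    = refl
  δ-comm (suc i) (suc j) = δ-comm i j

  -- Vectors and the potential

  Vector : ℕ → Set
  Vector w = Fin w → ℚ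

  basis : ∀ {w} → Fin w → Vector w
  basis i j = 𝟙 (does (i Fin.≟ j))

  infixl 8 _∙_
  -- The permutation matrix of `π` applied to the column `z`. A row `u` times the same matrix is
  -- `u ∙ flip π`.
  _∙_ : ∀ {w} → Vector w → Permutation′ w → Vector w
  (z ∙ π) i = z (π ⟨$⟩ʳ i)

  ⟪_,_⟫ : ∀ {w} → Vector w → Vector w → ℚ
  ⟪ u , z ⟫ = sum (λ i → u i * z i)

  ⟪⟫-cong : ∀ {w} {u u′ z z′ : Vector w} →
    (∀ i → u i ≡ u′ i) → (∀ i → z i ≡ z′ i) → ⟪ u , z ⟫ ≡ ⟪ u′ , z′ ⟫
  ⟪⟫-cong u≗u′ z≗z′ = sum-cong-≗ (λ i → cong₂ _*_ (u≗u′ i) (z≗z′ i))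

  ⟪basis,⟫ : ∀ {w} i (z : Vector w) → ⟪ basis i , z ⟫ ≡ z i
  ⟪basis,⟫ i z = sum-δ z i

  ⟪,basis⟫ : ∀ {w} (u : Vector w) j → ⟪ u , basis j ⟫ ≡ u j
  ⟪,basis⟫ u j = trans (sum-cong-≗ (λ i → ℚ.*-comm (u i) (basis j i))) (sum-δ u j)

  dist : ∀ {w} → Vector w → Vector w → ℚ
  dist p q = sum (λ i → ∣ p i - q i ∣)

  dist-nonneg : ∀ {w} (p q : Vector w) → 0ℚ ≤ dist p q
  dist-nonneg {w} p q = ∑ꟳ w .nonneg (λ i → ℚ.0≤∣p∣ (p i - q i))

  ∣p-r∣≤∣p-q∣+∣q-r∣ : ∀ p q r → ∣ p - r ∣ ≤ ∣ p - q ∣ + ∣ q - r ∣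
  ∣p-r∣≤∣p-q∣+∣q-r∣ p q r =
    subst (λ x → ∣ x ∣ ≤ ∣ p - q ∣ + ∣ q - r ∣) (lemma p q r) (ℚ.∣p+q∣≤∣p∣+∣q∣ (p - q) (q - r))
    where
    lemma : ∀ p q r → (p - q) + (q - r) ≡ p - r
    lemma = solve-∀ ℚ-ring

  dist-triangle : ∀ {w} (p q r : Vector w) → dist p r ≤ dist p q + dist q r
  dist-triangle {w} p q r = ℚ.≤-trans
    (mono (∑ꟳ w) (λ i → ∣p-r∣≤∣p-q∣+∣q-r∣ (p i) (q i) (r i)))
    (ℚ.≤-reflexive (∑ꟳ w .at-+ (λ i → ∣ p i - q i ∣) (λ i → ∣ q i - r i ∣)))

  -- A permutation only reorders the summands. A map that is not injective could repeat a coordinate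
  -- and stretch the distance.
  dist-∙ : ∀ {w} (p q : Vector w) π → dist (p ∙ π) (q ∙ π) ≡ dist p q
  dist-∙ p q π = sym (sum-permute (λ i → ∣ p i - q i ∣) π)

  adjoint : ∀ {w} (u z : Vector w) π → ⟪ u ∙ flip π , z ⟫ ≡ ⟪ u , z ∙ π ⟫
  adjoint u z π = trans (sum-permute (λ j → u (π ⟨$⟩ˡ j) * z j) π)
    (sum-cong-≗ (λ i → cong (λ k → u k * z (π ⟨$⟩ʳ i)) (inverseˡ π)))

  mix : ∀ {w} → Vector w → Vector w → Vector w
  mix p q i = ½ * (p i + q i)

  -- The ℓ¹ distance of `p`, and equally of `q`, from their midpoint `mix p q`.
  gap : ∀ {w} → Vector w → Vector w → ℚ
  gap p q = ½ * dist p q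

  gap-nonneg : ∀ {w} (p q : Vector w) → 0ℚ ≤ gap p q
  gap-nonneg p q = *-nonneg 0≤½ (dist-nonneg p q)

  dist-mixˡ : ∀ {w} (p q : Vector w) → dist p (mix p q) ≡ gap p q
  dist-mixˡ {w} p q = trans
    (sum-cong-≗ (λ i → trans (cong ∣_∣ (lemma (p i) (q i))) (ℚ.∣p*q∣≡∣p∣*∣q∣ ½ (p i - q i))))
    (∑ꟳ w .at-* ½ (λ i → ∣ p i - q i ∣))
    where
    lemma : ∀ a b → a - ½ * (a + b) ≡ ½ * (a - b)
    lemma = solve-∀ ℚ-ring

  dist-mixʳ : ∀ {w} (p q : Vector w) → dist q (mix p q) ≡ gap p q
  dist-mixʳ {w} p q = trans
    (sum-cong-≗ (λ i → trans (cong ∣_∣ (lemma (p i) (q i)))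
      (trans (ℚ.∣p*q∣≡∣p∣*∣q∣ ½ (q i - p i)) (cong (½ *_) (∣-∣-swap (q i) (p i))))))
    (∑ꟳ w .at-* ½ (λ i → ∣ p i - q i ∣))
    where
    lemma : ∀ a b → b - ½ * (a + b) ≡ ½ * (b - a)
    lemma = solve-∀ ℚ-ring

  spread : ∀ {w} → Vector w → ℚ
  spread z = sum (λ i → dist (λ _ → z i) z)

  spread-nonneg : ∀ {w} (z : Vector w) → 0ℚ ≤ spread z
  spread-nonneg {w} z = ∑ꟳ w .nonneg (λ i → dist-nonneg (λ _ → z i) z)

  ¼ : ℚ
  ¼ = ½ * ½

  -- With p = z ∙ π and q = z ∙ ρ, each of the four families |p i - p j|, |q i - q j|,
  -- |p i - q j|, |q i - p j| sums to spread z; their average dominates the (i , j) term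
  -- of spread (mix p q), and on the diagonal it exceeds it by ½ |p i - q i|.
  spread-mix : ∀ {w} (z : Vector w) π ρ →
    spread (mix (z ∙ π) (z ∙ ρ)) + gap (z ∙ π) (z ∙ ρ) ≤ spread z
  spread-mix {w} z π ρ = subst₂ _≤_ lhs rhs (mono Σ² (λ (i , j) → term i j))
    where
    p = z ∙ π
    q = z ∙ ρ
    m = mix p q
    Σ² = ∑ꟳ w ⊗ ∑ꟳ w
    pp qq pq qp off diag : Fin w × Fin w → ℚ
    pp (i , j)   = ∣ p i - p j ∣
    qq (i , j)   = ∣ q i - q j ∣
    pq (i , j)   = ∣ p i - q j ∣
    qp (i , j)   = ∣ q i - p j ∣
    off (i , j)  = ∣ m i - m j ∣
    diag (i , j) = 𝟙 (does (i Fin.≟ j)) * (½ * ∣ p i - q i ∣)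

    term : ∀ i j → off (i , j) + diag (i , j) ≤
      ¼ * ((pp (i , j) + qq (i , j)) + (pq (i , j) + qp (i , j)))
    term i j with i Fin.≟ j
    ... | yes refl = ℚ.≤-reflexive (equality (p i) (q i))
      where
      half : ∀ x → 0ℚ + 1ℚ * (½ * x) ≡ ¼ * ((0ℚ + 0ℚ) + (x + x))
      half = solve-∀ ℚ-ring
      self : ∀ x → ∣ x - x ∣ ≡ 0ℚ
      self x = cong ∣_∣ (ℚ.+-inverseʳ x)
      equality : ∀ a b → ∣ ½ * (a + b) - ½ * (a + b) ∣ + 1ℚ * (½ * ∣ a - b ∣) ≡
        ¼ * ((∣ a - a ∣ + ∣ b - b ∣) + (∣ a - b ∣ + ∣ b - a ∣))
      equality a b = trans (cong (_+ 1ℚ * (½ * ∣ a - b ∣)) (self (½ * (a + b))))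
        (trans (half ∣ a - b ∣) (cong (¼ *_)
          (sym (cong₂ _+_ (cong₂ _+_ (self a) (self b)) (cong (∣ a - b ∣ +_) (∣-∣-swap b a))))))
    ... | no _ = begin
      ∣ m i - m j ∣ + 0ℚ * (½ * ∣ p i - q i ∣) ≡⟨ drop-zero ∣ m i - m j ∣ (½ * ∣ p i - q i ∣) ⟩
      ∣ m i - m j ∣                            ≡⟨ cong ∣_∣ (split (p i) (q i) (p j) (q j)) ⟩
      ∣ ¼ * ((a + b) + (c + d)) ∣              ≡⟨ ℚ.∣p*q∣≡∣p∣*∣q∣ ¼ ((a + b) + (c + d)) ⟩
      ¼ * ∣ (a + b) + (c + d) ∣                ≤⟨ *-monoˡ 0≤¼ (ℚ.∣p+q∣≤∣p∣+∣q∣ (a + b) (c + d)) ⟩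
      ¼ * (∣ a + b ∣ + ∣ c + d ∣)
        ≤⟨ *-monoˡ 0≤¼ (ℚ.+-mono-≤ (ℚ.∣p+q∣≤∣p∣+∣q∣ a b) (ℚ.∣p+q∣≤∣p∣+∣q∣ c d)) ⟩
      ¼ * ((∣ a ∣ + ∣ b ∣) + (∣ c ∣ + ∣ d ∣))  ∎
      where
      open ℚ.≤-Reasoning
      a = p i - p j
      b = q i - q j
      c = p i - q j
      d = q i - p j
      0≤¼ : 0ℚ ≤ ¼
      0≤¼ = ℚ.nonNegative⁻¹ ¼
      drop-zero : ∀ x y → x + 0ℚ * y ≡ x
      drop-zero = solve-∀ ℚ-ring
      split : ∀ pi qi pj qj → ½ * (pi + qi) - ½ * (pj + qj) ≡
        ½ * ½ * (((pi - pj) + (qi - qj)) + ((pi - qj) + (qi - pj)))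
      split = solve-∀ ℚ-ring

    lhs : at Σ² (λ ij → off ij + diag ij) ≡ spread m + gap p q
    lhs = trans (at-+ Σ² off diag) (cong (spread m +_)
      (trans (sum-cong-≗ (λ i → sum-δ (λ _ → ½ * ∣ p i - q i ∣) i))
             (∑ꟳ w .at-* ½ (λ i → ∣ p i - q i ∣))))

    relabel : ∀ σ τ → at Σ² (λ (i , j) → ∣ (z ∙ σ) i - (z ∙ τ) j ∣) ≡ spread z
    relabel σ τ = trans
      (sum-cong-≗ (λ i → sym (sum-permute (λ j → ∣ z (σ ⟨$⟩ʳ i) - z j ∣) τ)))
      (sym (sum-permute (λ i → sum (λ j → ∣ z i - z j ∣)) σ))

    rhs : at Σ² (λ ij → ¼ * ((pp ij + qq ij) + (pq ij + qp ij))) ≡ spread z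
    rhs = trans (at-* Σ² ¼ (λ ij → (pp ij + qq ij) + (pq ij + qp ij)))
      (trans (cong (¼ *_)
        (trans (at-+ Σ² (λ ij → pp ij + qq ij) (λ ij → pq ij + qp ij))
          (cong₂ _+_
            (trans (at-+ Σ² pp qq) (cong₂ _+_ (relabel π π) (relabel ρ ρ)))
            (trans (at-+ Σ² pq qp) (cong₂ _+_ (relabel π ρ) (relabel ρ π))))))
        (quarter (spread z)))
      where
      quarter : ∀ x → ½ * ½ * ((x + x) + (x + x)) ≡ x
      quarter = solve-∀ ℚ-ring

  width : ℕ → ℚ
  width w = sum {w} (λ _ → 1ℚ)

  width-nonneg : ∀ w → 0ℚ ≤ width w
  width-nonneg w = ∑ꟳ w .nonneg (λ _ → ℚ.nonNegative⁻¹ 1ℚ)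

  sum-const : ∀ w c → sum {w} (λ _ → c) ≡ c * width w
  sum-const w c = trans (sum-cong-≗ {w} (λ _ → sym (ℚ.*-identityʳ c))) (∑ꟳ w .at-* c (λ _ → 1ℚ))

  𝟙-nonneg : ∀ b → 0ℚ ≤ 𝟙 b
  𝟙-nonneg false = ℚ.≤-refl
  𝟙-nonneg true  = ℚ.nonNegative⁻¹ 1ℚ

  ∣𝟙-𝟙∣≤1 : ∀ a b → ∣ 𝟙 a - 𝟙 b ∣ ≤ 1ℚ
  ∣𝟙-𝟙∣≤1 false false = ℚ.nonNegative⁻¹ 1ℚ
  ∣𝟙-𝟙∣≤1 false true  = ℚ.≤-refl
  ∣𝟙-𝟙∣≤1 true  false = ℚ.≤-refl
  ∣𝟙-𝟙∣≤1 true  true  = ℚ.nonNegative⁻¹ 1ℚ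

  spread-indicator : ∀ {w} (s : Fin w → Bool) → spread (𝟙 ∘ s) ≤ width w * width w
  spread-indicator {w} s = ℚ.≤-trans
    (mono (∑ꟳ w ⊗ ∑ꟳ w) {g = λ _ → 1ℚ} (λ (i , j) → ∣𝟙-𝟙∣≤1 (s i) (s j)))
    (ℚ.≤-reflexive (sum-const w (width w)))

  -- Nonnegative entries with total 1 give a bound linear in the width. The quadratic bound for
  -- general indicators would raise the power of `w` in both the quadratic error term and the final
  -- error.
  spread-basis : ∀ {w} (i : Fin w) → spread (basis i) ≤ (1ℚ + 1ℚ) * width w
  spread-basis {w} i = ℚ.≤-trans
    (mono Σ² {g = λ (j , k) → basis i j + basis i k} (λ (j , k) → bound (basis i j) (basis i k)
      (𝟙-nonneg (does (i Fin.≟ j))) (𝟙-nonneg (does (i Fin.≟ k)))))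
    (ℚ.≤-reflexive (trans (at-+ Σ² (λ (j , k) → basis i j) (λ (j , k) → basis i k))
      (trans (cong₂ _+_
        (trans (sum-cong-≗ (λ j → sum-const w (basis i j)))
          (trans (at-*ʳ (∑ꟳ w) (width w) (basis i)) (cong (_* width w) total)))
        (trans (sum-const w (sum (basis i))) (cong (_* width w) total)))
        (double (width w)))))
    where
    Σ² = ∑ꟳ w ⊗ ∑ꟳ w
    bound : ∀ a b → 0ℚ ≤ a → 0ℚ ≤ b → ∣ a - b ∣ ≤ a + b
    bound a b 0≤a 0≤b =
      ∣p∣≤ (≤-by (b + b) (right a b) (+-nonneg 0≤b 0≤b)) (≤-by (a + a) (left a b) (+-nonneg 0≤a 0≤a))
      where
      right : ∀ a b → a + b ≡ (a - b) + (b + b)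
      right = solve-∀ ℚ-ring
      left : ∀ a b → a + b ≡ - (a - b) + (a + a)
      left = solve-∀ ℚ-ring
    total : sum (basis i) ≡ 1ℚ
    total = trans (sum-cong-≗ (λ j → sym (ℚ.*-identityʳ (basis i j)))) (sum-δ (λ _ → 1ℚ) i)
    double : ∀ x → 1ℚ * x + 1ℚ * x ≡ (1ℚ + 1ℚ) * x
    double = solve-∀ ℚ-ring

  -- Removes the tolerance built into `_≤ᴿ_` once both sides are rational: a rational strictly
  -- between `q` and `p` would refute the hypothesis.
  ≤-from-slack : ∀ {p q} → (∀ δ → 0ℚ < δ → p ≤ q + δ) → p ≤ q
  ≤-from-slack {p} {q} h = ℚ.≮⇒≥ (λ q<p → contradict (ℚ.<-dense q<p))
    where
    lemma : ∀ q r → q + (r - q) ≡ r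
    lemma = solve-∀ ℚ-ring
    contradict : (∃[ r ] q < r × r < p) → ⊥
    contradict (r , q<r , r<p) = ℚ.<-irrefl refl (ℚ.<-≤-trans r<p
      (subst (p ≤_) (lemma q r) (h (r - q)
        (subst (_< r - q) (ℚ.+-inverseʳ q) (ℚ.+-monoˡ-< (- q) q<r)))))

  -- Averages over bit strings and expanders

  nat : ℕ → ℚ
  nat n = ℤ.+ n / 1

  toℚᵘ-/ : ∀ i n-1 → toℚᵘ (i / suc n-1) ℚᵘ.≃ mkℚᵘ i n-1
  toℚᵘ-/ i n-1 = ℚ.toℚᵘ-fromℚᵘ (mkℚᵘ i n-1)

  nat-+ : ∀ m n → nat (m ℕ.+ n) ≡ nat m + nat n
  nat-+ m n = ℚ.toℚᵘ-injective (ℚᵘ.≃-trans (toℚᵘ-/ (ℤ.+ (m ℕ.+ n)) 0)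
    (ℚᵘ.≃-sym (ℚᵘ.≃-trans (ℚ.toℚᵘ-homo-+ (nat m) (nat n))
      (ℚᵘ.≃-trans (ℚᵘ.+-cong (toℚᵘ-/ (ℤ.+ m) 0) (toℚᵘ-/ (ℤ.+ n) 0)) (ℚᵘ.*≡* eq)))))
    where
    eq : (ℤ.+ m ℤ.* ℤ.+ 1 ℤ.+ ℤ.+ n ℤ.* ℤ.+ 1) ℤ.* ℤ.+ 1 ≡ ℤ.+ (m ℕ.+ n) ℤ.* ℤ.+ 1
    eq = cong (ℤ._* ℤ.+ 1) (cong₂ ℤ._+_ (ℤ.*-identityʳ (ℤ.+ m)) (ℤ.*-identityʳ (ℤ.+ n)))

  nat-* : ∀ m n → nat (m ℕ.* n) ≡ nat m * nat n
  nat-* m n = ℚ.toℚᵘ-injective (ℚᵘ.≃-trans (toℚᵘ-/ (ℤ.+ (m ℕ.* n)) 0)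
    (ℚᵘ.≃-sym (ℚᵘ.≃-trans (ℚ.toℚᵘ-homo-* (nat m) (nat n))
      (ℚᵘ.≃-trans (ℚᵘ.*-cong (toℚᵘ-/ (ℤ.+ m) 0) (toℚᵘ-/ (ℤ.+ n) 0))
        (ℚᵘ.*≡* (cong (ℤ._* ℤ.+ 1) (sym (ℤ.pos-* m n))))))))

  nat-nonneg : ∀ n → 0ℚ ≤ nat n
  nat-nonneg n = ℚ.nonNegative⁻¹ (nat n) {{ℚ.normalize-nonNeg n 1}}

  nat-mono : ∀ {m n} → m ℕ.≤ n → nat m ≤ nat n
  nat-mono {m} {n} m≤n = ≤-by (nat (n ℕ.∸ m))
    (trans (cong nat (sym (ℕ.m+[n∸m]≡n m≤n))) (nat-+ m (n ℕ.∸ m))) (nat-nonneg (n ℕ.∸ m))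

  recip : (n : ℕ) → .{{ℕ.NonZero n}} → ℚ
  recip n = ℤ.+ 1 / n

  recip-nonneg : ∀ n .{{_ : ℕ.NonZero n}} → 0ℚ ≤ recip n
  recip-nonneg n = ℚ.nonNegative⁻¹ (recip n) {{ℚ.normalize-nonNeg 1 n}}

  recip-* : ∀ n .{{_ : ℕ.NonZero n}} → recip n * nat n ≡ 1ℚ
  recip-* (suc n-1) = ℚ.toℚᵘ-injective (ℚᵘ.≃-trans (ℚ.toℚᵘ-homo-* (recip n) (nat n))
    (ℚᵘ.≃-trans (ℚᵘ.*-cong (toℚᵘ-/ (ℤ.+ 1) n-1) (toℚᵘ-/ (ℤ.+ n) 0))
      (ℚᵘ.*≡* (trans (ℤ.*-identityʳ (ℤ.+ 1 ℤ.* ℤ.+ n)) (cong (λ k → ℤ.+ 1 ℤ.* ℤ.+ k) (sym (ℕ.*-identityʳ n)))))))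
    where n = suc n-1

  1/2^-nonneg : ∀ m → 0ℚ ≤ 1/2^ m
  1/2^-nonneg m = recip-nonneg (2 ℕ.^ m) {{ℕ.m^n≢0 2 m}}

  1/2^-suc : ∀ m → 1/2^ (suc m) ≡ ½ * 1/2^ m
  1/2^-suc m = begin
    x                   ≡⟨ sym (ℚ.*-identityʳ x) ⟩
    x * 1ℚ              ≡⟨ cong (x *_) (sym (recip-* (2 ℕ.^ m) {{ℕ.m^n≢0 2 m}})) ⟩
    x * (y * N)         ≡⟨ rearrange x y N ⟩
    (x * (nat 2 * N)) * (½ * y)
      ≡⟨ cong (λ z → (x * z) * (½ * y)) (sym (nat-* 2 (2 ℕ.^ m))) ⟩
    (x * nat (2 ℕ.^ suc m)) * (½ * y)
      ≡⟨ cong (_* (½ * y)) (recip-* (2 ℕ.^ suc m) {{ℕ.m^n≢0 2 (suc m)}}) ⟩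
    1ℚ * (½ * y)        ≡⟨ ℚ.*-identityˡ (½ * y) ⟩
    ½ * y               ∎
    where
    open ≡-Reasoning
    x = 1/2^ (suc m)
    y = 1/2^ m
    N = nat (2 ℕ.^ m)
    rearrange : ∀ x y N → x * (y * N) ≡ (x * (nat 2 * N)) * (½ * y)
    rearrange = solve-∀ ℚ-ring

  mean : ∀ m → Functional (Bits m)
  mean m = scaled (1/2^ m) (1/2^-nonneg m) (∑ᴮ m)

  𝔼-zero : ∀ (f : Bits 0 → ℚ) → 𝔼 0 f ≡ f []
  𝔼-zero f = ℚ.*-identityˡ (f [])

  𝔼-suc : ∀ m (f : Bits (suc m) → ℚ) →
    𝔼 (suc m) f ≡ ½ * (𝔼 m (f ∘ (false ∷_)) + 𝔼 m (f ∘ (true ∷_)))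
  𝔼-suc m f = trans (cong (_* (a + b)) (1/2^-suc m)) (lemma (1/2^ m) a b)
    where
    a = ∑ᵇ _+_ m (f ∘ (false ∷_))
    b = ∑ᵇ _+_ m (f ∘ (true ∷_))
    lemma : ∀ y a b → (½ * y) * (a + b) ≡ ½ * (y * a + y * b)
    lemma = solve-∀ ℚ-ring

  𝔼-const : ∀ m c → 𝔼 m (λ _ → c) ≡ c
  𝔼-const zero    c = 𝔼-zero (λ _ → c)
  𝔼-const (suc m) c = trans (𝔼-suc m (λ _ → c))
    (trans (cong (λ x → ½ * (x + x)) (𝔼-const m c)) (lemma c))
    where
    lemma : ∀ x → ½ * (x + x) ≡ x
    lemma = solve-∀ ℚ-ring

  𝔼-split : ∀ m {d} (f : Bits m → Bits d → ℚ) →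
    𝔼 (m ℕ.+ d) (λ s → f (take m s) (drop m s)) ≡ 𝔼 m (λ x → 𝔼 d (f x))
  𝔼-split zero        f = sym (𝔼-zero (λ x → 𝔼 _ (f x)))
  𝔼-split (suc m) {d} f = trans (𝔼-suc (m ℕ.+ d) (λ s → f (take (suc m) s) (drop (suc m) s)))
    (trans (cong₂ (λ a b → ½ * (a + b)) (𝔼-split m (f ∘ (false ∷_))) (𝔼-split m (f ∘ (true ∷_))))
           (sym (𝔼-suc m (λ x → 𝔼 d (f x)))))

  ∑ᵇ-δ : ∀ m (f : Bits m → ℚ) x →
    ∑ᵇ _+_ m (λ y → 𝟙 (does (Vec.≡-dec Bool._≟_ x y)) * f y) ≡ f x
  ∑ᵇ-δ zero    f []      = ℚ.*-identityˡ (f [])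
  ∑ᵇ-δ (suc m) f (b ∷ x) = pick b
    where
    vanish : ∀ c → ∑ᵇ _+_ m (λ y → 0ℚ * f (c ∷ y)) ≡ 0ℚ
    vanish c = trans (at-* (∑ᴮ m) 0ℚ (f ∘ (c ∷_))) (ℚ.*-zeroˡ (∑ᵇ _+_ m (f ∘ (c ∷_))))
    pick : ∀ b → ∑ᵇ _+_ (suc m) (λ y → 𝟙 (does (Vec.≡-dec Bool._≟_ (b ∷ x) y)) * f y) ≡ f (b ∷ x)
    pick false = trans (cong₂ _+_ (∑ᵇ-δ m (f ∘ (false ∷_)) x) (vanish true)) (ℚ.+-identityʳ (f (false ∷ x)))
    pick true  = trans (cong₂ _+_ (vanish false) (∑ᵇ-δ m (f ∘ (true ∷_)) x)) (ℚ.+-identityˡ (f (true ∷ x)))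

  seq-∑ᵇ : ∀ m (f : Bits m → ℝ) k → seq (∑ᵇ _+ᴿ_ m f) k ≡ ∑ᵇ _+_ m (λ x → seq (f x) k)
  seq-∑ᵇ zero    f k = refl
  seq-∑ᵇ (suc m) f k = cong₂ _+_ (seq-∑ᵇ m (f ∘ (false ∷_)) k) (seq-∑ᵇ m (f ∘ (true ∷_)) k)

  square-seq : ∀ x k → seq (x ^ᴿ 2) k ≡ seq x k * seq x k
  square-seq x k = cong (seq x k *_) (ℚ.*-identityʳ (seq x k))

  seq-∑ᵇ-square : ∀ m (f : Bits m → ℝ) k →
    seq (∑ᵇ _+ᴿ_ m (λ x → f x ^ᴿ 2)) k ≡ ∑ᵇ _+_ m (λ x → seq (f x) k * seq (f x) k)
  seq-∑ᵇ-square m f k = trans (seq-∑ᵇ m (λ x → f x ^ᴿ 2) k) (at-cong (∑ᴮ m) (λ x → square-seq (f x) k))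

  -- A real lying in the rational interval from 0 to `L`, stated on its sequence. The lower bound is
  -- what allows the upper one to be squared.
  EventuallyWithin : ℝ → ℚ → Set
  EventuallyWithin s L = ∃[ N ] ∀ k → N ℕ.≤ k → 0ℚ ≤ seq s k × seq s k ≤ L

  ≤ᴿ-instance : ∀ {x y} → x ≤ᴿ y → ∀ δ → 0ℚ < δ → ∀ N → ∃[ k ] N ℕ.≤ k × seq x k ≤ seq y k + δ
  ≤ᴿ-instance x≤y δ 0<δ N =
    N ℕ.⊔ proj₁ (x≤y δ 0<δ) , ℕ.m≤m⊔n N _ , proj₂ (x≤y δ 0<δ) _ (ℕ.m≤n⊔m N _)

  -- The real bound is tested on constant sequences. At a late enough index it is a statement about
  -- rationals with `s` replaced by at most `L`, and the tolerance is then removed.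
  SpectralNorm≤⇒ : ∀ {m} {A : BitMatrix m} {s L} → SpectralNorm≤ A s → EventuallyWithin s L →
    ∀ (v : Bits m → ℚ) →
    ∑ᵇ _+_ m (λ x → ∑ᵇ _+_ m (λ y → A x y * v y) * ∑ᵇ _+_ m (λ y → A x y * v y))
      ≤ L * L * ∑ᵇ _+_ m (λ x → v x * v x)
  SpectralNorm≤⇒ {m} {A} {s} {L} (_ , bound) (N , s≤L) v = ≤-from-slack slack
    where
    Q = ∑ᵇ _+_ m (λ x → v x * v x)
    Av : Bits m → ℚ
    Av x = ∑ᵇ _+_ m (λ y → A x y * v y)
    0≤Q : 0ℚ ≤ Q
    0≤Q = nonneg (∑ᴮ m) (λ x → square-nonneg (v x))
    lhs : ∀ k →
      seq (∑ᵇ _+ᴿ_ m (λ x → ∑ᵇ _+ᴿ_ m (λ y → fromℚ (A x y) *ᴿ fromℚ (v y)) ^ᴿ 2)) k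
        ≡ ∑ᵇ _+_ m (λ x → Av x * Av x)
    lhs k = trans (seq-∑ᵇ-square m (λ x → ∑ᵇ _+ᴿ_ m (λ y → fromℚ (A x y) *ᴿ fromℚ (v y))) k)
      (at-cong (∑ᴮ m) (λ x → cong (λ p → p * p) (seq-∑ᵇ m (λ y → fromℚ (A x y) *ᴿ fromℚ (v y)) k)))
    rhs : ∀ k → seq (s ^ᴿ 2 *ᴿ ∑ᵇ _+ᴿ_ m (λ x → fromℚ (v x) ^ᴿ 2)) k ≡ seq s k * seq s k * Q
    rhs k = cong₂ _*_ (square-seq s k) (seq-∑ᵇ-square m (λ x → fromℚ (v x)) k)
    slack : ∀ δ → 0ℚ < δ → ∑ᵇ _+_ m (λ x → Av x * Av x) ≤ L * L * Q + δ
    slack δ 0<δ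
      using k , N≤k , ineq ← ≤ᴿ-instance
        {∑ᵇ _+ᴿ_ m (λ x → ∑ᵇ _+ᴿ_ m (λ y → fromℚ (A x y) *ᴿ fromℚ (v y)) ^ᴿ 2)}
        {s ^ᴿ 2 *ᴿ ∑ᵇ _+ᴿ_ m (λ x → fromℚ (v x) ^ᴿ 2)}
        (bound (λ y → fromℚ (v y))) δ 0<δ N = ℚ.≤-trans
        (subst₂ (λ a b → a ≤ b + δ) (lhs k) (rhs k) ineq)
        (ℚ.+-monoˡ-≤ δ (*-monoʳ 0≤Q (*-mono 0≤sₖ (ℚ.≤-trans 0≤sₖ sₖ≤L) sₖ≤L sₖ≤L)))
      where
      0≤sₖ = proj₁ (s≤L k N≤k)
      sₖ≤L = proj₂ (s≤L k N≤k)

  module _ {m d : ℕ} (K : RegularGraph m d) where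

    -- The operator M/D - J whose norm defines an expander, applied to `v`: the average over
    -- neighbours minus the global average.
    bias : (Bits m → ℚ) → Bits m → ℚ
    bias v x = 𝔼 d (v ∘ neighbor K x) - 𝔼 m v

    Contracts : ℚ → Set
    Contracts L = ∀ v → 𝔼 m (λ x → bias v x * bias v x) ≤ L * L * 𝔼 m (λ x → v x * v x)

    adjacency-average : ∀ (v : Bits m → ℚ) x →
      ∑ᵇ _+_ m (λ y → (1/2^ d * adjacency K x y) * v y) ≡ 𝔼 d (v ∘ neighbor K x)
    adjacency-average v x = trans
      (at-cong (∑ᴮ m) (λ y → trans (ℚ.*-assoc (1/2^ d) (adjacency K x y) (v y))
        (cong (1/2^ d *_) (sym (at-*ʳ (∑ᴮ d) (v y) (λ e → hit e y))))))
      (trans (at-* (∑ᴮ m) (1/2^ d) (λ y → ∑ᵇ _+_ d (λ e → hit e y * v y)))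
        (cong (1/2^ d *_) (trans (at-∑ᵇ d (∑ᴮ m) (λ y e → hit e y * v y))
          (at-cong (∑ᴮ d) (λ e → ∑ᵇ-δ m v (neighbor K x e))))))
      where
      hit : Bits d → Bits m → ℚ
      hit e y = 𝟙 (does (Vec.≡-dec Bool._≟_ (neighbor K x e) y))

    -- The uniform distribution is stationary: by symmetry the columns of the normalised adjacency
    -- matrix sum to 1, as its rows do.
    𝔼-neighbor : ∀ (v : Bits m → ℚ) → 𝔼 m (λ x → 𝔼 d (v ∘ neighbor K x)) ≡ 𝔼 m v
    𝔼-neighbor v = cong (1/2^ m *_) (begin
      ∑ᵇ _+_ m (λ x → 𝔼 d (v ∘ neighbor K x))
        ≡⟨ at-cong (∑ᴮ m) (λ x → sym (adjacency-average v x)) ⟩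
      ∑ᵇ _+_ m (λ x → ∑ᵇ _+_ m (λ y → (1/2^ d * adjacency K x y) * v y))
        ≡⟨ at-∑ᵇ m (∑ᴮ m) (λ x y → (1/2^ d * adjacency K x y) * v y) ⟩
      ∑ᵇ _+_ m (λ y → ∑ᵇ _+_ m (λ x → (1/2^ d * adjacency K x y) * v y))
        ≡⟨ at-cong (∑ᴮ m) (λ y → trans
             (at-cong (∑ᴮ m) (λ x → trans
               (cong (λ a → (1/2^ d * a) * v y) (undirected K x y))
               (lemma (1/2^ d * adjacency K y x) (v y))))
             (at-*ʳ (∑ᴮ m) (v y) (λ x → (1/2^ d * adjacency K y x) * 1ℚ))) ⟩
      ∑ᵇ _+_ m (λ y → ∑ᵇ _+_ m (λ x → (1/2^ d * adjacency K y x) * 1ℚ) * v y)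
        ≡⟨ at-cong (∑ᴮ m) (λ y → trans
             (cong (_* v y) (trans (adjacency-average (λ _ → 1ℚ) y) (𝔼-const d 1ℚ)))
             (ℚ.*-identityˡ (v y))) ⟩
      ∑ᵇ _+_ m v ∎)
      where
      open ≡-Reasoning
      lemma : ∀ a b → a * b ≡ (a * 1ℚ) * b
      lemma = solve-∀ ℚ-ring

    𝔼-bias : ∀ v → 𝔼 m (bias v) ≡ 0ℚ
    𝔼-bias v = trans (at-∸ (mean m) (λ x → 𝔼 d (v ∘ neighbor K x)) (λ _ → 𝔼 m v))
      (trans (cong₂ _-_ (𝔼-neighbor v) (𝔼-const m (𝔼 m v))) (ℚ.+-inverseʳ (𝔼 m v)))

    bias-shift : ∀ v c x → bias (λ y → v y - c) x ≡ bias v x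
    bias-shift v c x = trans
      (cong₂ _-_
        (trans (at-∸ (mean d) (v ∘ neighbor K x) (λ _ → c)) (cong (λ p → 𝔼 d (v ∘ neighbor K x) - p) (𝔼-const d c)))
        (trans (at-∸ (mean m) v (λ _ → c)) (cong (λ p → 𝔼 m v - p) (𝔼-const m c))))
      (lemma (𝔼 d (v ∘ neighbor K x)) (𝔼 m v) c)
      where
      lemma : ∀ a b c → (a - c) - (b - c) ≡ a - b
      lemma = solve-∀ ℚ-ring

    expander-contracts : ∀ {s L} → IsExpander s K → EventuallyWithin s L → Contracts L
    expander-contracts {s} {L} expander s≤L v = begin
      1/2^ m * ∑ᵇ _+_ m (λ x → bias v x * bias v x)
        ≡⟨ cong (1/2^ m *_) (at-cong (∑ᴮ m) (λ x → cong (λ p → p * p) (sym (apply x)))) ⟩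
      1/2^ m * ∑ᵇ _+_ m (λ x → Bv x * Bv x)
        ≤⟨ *-monoˡ (1/2^-nonneg m) (SpectralNorm≤⇒ {A = λ x y → 1/2^ d * adjacency K x y - 1/2^ m} {s} expander s≤L v) ⟩
      1/2^ m * (L * L * ∑ᵇ _+_ m (λ x → v x * v x))
        ≡⟨ lemma (1/2^ m) (L * L) (∑ᵇ _+_ m (λ x → v x * v x)) ⟩
      L * L * 𝔼 m (λ x → v x * v x) ∎
      where
      open ℚ.≤-Reasoning
      Bv : Bits m → ℚ
      Bv x = ∑ᵇ _+_ m (λ y → (1/2^ d * adjacency K x y - 1/2^ m) * v y)
      lemma : ∀ a b c → a * (b * c) ≡ b * (a * c)
      lemma = solve-∀ ℚ-ring
      distrib : ∀ a b c → (a - b) * c ≡ a * c - b * c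
      distrib = solve-∀ ℚ-ring
      apply : ∀ x → Bv x ≡ bias v x
      apply x = trans
        (at-cong (∑ᴮ m) (λ y → distrib (1/2^ d * adjacency K x y) (1/2^ m) (v y)))
        (trans (at-∸ (∑ᴮ m) (λ y → (1/2^ d * adjacency K x y) * v y) (λ y → 1/2^ m * v y))
          (cong₂ _-_ (adjacency-average v x) (at-* (∑ᴮ m) (1/2^ m) v)))

  -- Expander mixing for vector-valued functions

  module _ {A : Set} (Λ : Functional A) {w : ℕ} where

    atᵛ : (A → Vector w) → Vector w
    atᵛ f j = at Λ (λ x → f x j)

    at-⟪⟫ʳ : ∀ u (g : A → Vector w) → at Λ (λ x → ⟪ u , g x ⟫) ≡ ⟪ u , atᵛ g ⟫
    at-⟪⟫ʳ u g = trans (at-sum Λ (λ x i → u i * g x i))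
      (sum-cong-≗ (λ i → at-* Λ (u i) (λ x → g x i)))

    at-⟪⟫ˡ : ∀ (f : A → Vector w) z → at Λ (λ x → ⟪ f x , z ⟫) ≡ ⟪ atᵛ f , z ⟫
    at-⟪⟫ˡ f z = trans (at-sum Λ (λ x i → f x i * z i))
      (sum-cong-≗ (λ i → at-*ʳ Λ (z i) (λ x → f x i)))

  infixl 7 _⊖_
  _⊖_ : ∀ {w} → Vector w → Vector w → Vector w
  (p ⊖ q) i = p i - q i

  ⟪⟫-⊖ʳ : ∀ {w} (u p q : Vector w) → ⟪ u , p ⊖ q ⟫ ≡ ⟪ u , p ⟫ - ⟪ u , q ⟫
  ⟪⟫-⊖ʳ {w} u p q = trans (sum-cong-≗ (λ i → lemma (u i) (p i) (q i)))
    (at-∸ (∑ꟳ w) (λ i → u i * p i) (λ i → u i * q i))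
    where
    lemma : ∀ a b c → a * (b - c) ≡ a * b - a * c
    lemma = solve-∀ ℚ-ring

  ⟪⟫-⊖ˡ : ∀ {w} (u p q : Vector w) → ⟪ p ⊖ q , u ⟫ ≡ ⟪ p , u ⟫ - ⟪ q , u ⟫
  ⟪⟫-⊖ˡ {w} u p q = trans (sum-cong-≗ (λ i → lemma (u i) (p i) (q i)))
    (at-∸ (∑ꟳ w) (λ i → p i * u i) (λ i → q i * u i))
    where
    lemma : ∀ a b c → (b - c) * a ≡ b * a - c * a
    lemma = solve-∀ ℚ-ring

  sum-squares≤ : ∀ {n} (f : Fin n → ℚ) → (∀ i → 0ℚ ≤ f i) → sum (λ i → f i * f i) ≤ sum f * sum f
  sum-squares≤ {zero}  f 0≤f = ℚ.≤-refl
  sum-squares≤ {suc n} f 0≤f = ℚ.≤-trans (ℚ.+-monoʳ-≤ (a * a) (sum-squares≤ (f ∘ suc) (0≤f ∘ suc)))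
    (≤-by (a * s + a * s) (lemma a s) (+-nonneg 0≤as 0≤as))
    where
    a = f zero
    s = sum (f ∘ suc)
    0≤as = *-nonneg (0≤f zero) (∑ꟳ n .nonneg (0≤f ∘ suc))
    lemma : ∀ a s → (a + s) * (a + s) ≡ (a * a + s * s) + (a * s + a * s)
    lemma = solve-∀ ℚ-ring

  sum-squares≤dist² : ∀ {w} (p q : Vector w) →
    sum (λ i → (p ⊖ q) i * (p ⊖ q) i) ≤ dist p q * dist p q
  sum-squares≤dist² p q = subst (_≤ dist p q * dist p q)
    (sum-cong-≗ (λ i → ∣-∣-square (p i - q i)))
    (sum-squares≤ (λ i → ∣ p i - q i ∣) (λ i → ℚ.0≤∣p∣ (p i - q i)))

  -- The difference is the mean of `f` paired with the bias of `g`. The bias has mean zero and does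
  -- not see constants, so `f` and `g` may be centred at any `p` and `q`. Cauchy-Schwarz over vertex
  -- and coordinate together, the contraction in each coordinate of `g`, and ℓ² norm at most ℓ¹ norm
  -- then give the product bound.
  decorrelate : ∀ {m d w} (K : RegularGraph m d) {L a b} → 0ℚ ≤ L → 0ℚ ≤ a → 0ℚ ≤ b → Contracts K L →
    ∀ (f g : Bits m → Vector w) (p q : Vector w) →
    (∀ x → dist (f x) p ≤ a) → (∀ x → dist (g x) q ≤ b) →
    ∣ 𝔼 m (λ x → 𝔼 d (λ e → ⟪ f x , g (neighbor K x e) ⟫)) - ⟪ atᵛ (mean m) f , atᵛ (mean m) g ⟫ ∣
      ≤ L * (a * b)
  decorrelate {m} {d} {w} K {L} {a} {b} 0≤L 0≤a 0≤b contracts f g p q f≤a g≤b =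
    subst (λ x → ∣ x ∣ ≤ L * (a * b)) (sym centred)
      (square-cancel-≤ (*-nonneg 0≤L (*-nonneg 0≤a 0≤b))
        (subst (_≤ L * (a * b) * (L * (a * b))) (sym (∣-∣-square S)) S²≤))
    where
    Λ = mean m ⊗ ∑ꟳ w
    g̅ = atᵛ (mean m) g
    h : Bits m → Vector w
    h x j = bias K (λ y → g y j) x
    F G Hf : Bits m × Fin w → ℚ
    F (x , j)  = f x j - p j
    G (x , j)  = g x j - q j
    Hf (x , j) = h x j
    S = at Λ (λ xj → F xj * Hf xj)

    centred : 𝔼 m (λ x → 𝔼 d (λ e → ⟪ f x , g (neighbor K x e) ⟫)) - ⟪ atᵛ (mean m) f , g̅ ⟫ ≡ S
    centred = begin
      𝔼 m (λ x → 𝔼 d (λ e → ⟪ f x , g (neighbor K x e) ⟫)) - ⟪ atᵛ (mean m) f , g̅ ⟫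
        ≡⟨ cong₂ _-_ (at-cong (mean m) (λ x → at-⟪⟫ʳ (mean d) (f x) (λ e → g (neighbor K x e))))
                     (sym (at-⟪⟫ˡ (mean m) f g̅)) ⟩
      𝔼 m (λ x → ⟪ f x , Tg x ⟫) - 𝔼 m (λ x → ⟪ f x , g̅ ⟫)
        ≡⟨ sym (at-∸ (mean m) (λ x → ⟪ f x , Tg x ⟫) (λ x → ⟪ f x , g̅ ⟫)) ⟩
      𝔼 m (λ x → ⟪ f x , Tg x ⟫ - ⟪ f x , g̅ ⟫)
        ≡⟨ at-cong (mean m) (λ x → sym (⟪⟫-⊖ʳ (f x) (Tg x) g̅)) ⟩
      𝔼 m (λ x → ⟪ f x , h x ⟫)
        -- Centring at `p` costs nothing: the inserted term is `p` paired with a vector of mean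
        -- zero.
        ≡⟨ sym (trans (cong (λ y → 𝔼 m (λ x → ⟪ f x , h x ⟫) - y) no-bias) (minus-zero _)) ⟩
      𝔼 m (λ x → ⟪ f x , h x ⟫) - 𝔼 m (λ x → ⟪ p , h x ⟫)
        ≡⟨ sym (at-∸ (mean m) (λ x → ⟪ f x , h x ⟫) (λ x → ⟪ p , h x ⟫)) ⟩
      𝔼 m (λ x → ⟪ f x , h x ⟫ - ⟪ p , h x ⟫)
        ≡⟨ at-cong (mean m) (λ x → sym (⟪⟫-⊖ˡ (h x) (f x) p)) ⟩
      S ∎
      where
      open ≡-Reasoning
      Tg : Bits m → Vector w
      Tg x j = 𝔼 d (λ e → g (neighbor K x e) j)
      minus-zero : ∀ x → x - 0ℚ ≡ x
      minus-zero = solve-∀ ℚ-ring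
      no-bias : 𝔼 m (λ x → ⟪ p , h x ⟫) ≡ 0ℚ
      no-bias = trans (at-⟪⟫ʳ (mean m) p h)
        (trans (sum-cong-≗ (λ j → trans (cong (p j *_) (𝔼-bias K (λ y → g y j))) (ℚ.*-zeroʳ (p j))))
               (at-0 (∑ꟳ w)))

    deviation : ∀ {c} (k : Bits m → Vector w) r → 0ℚ ≤ c → (∀ x → dist (k x) r ≤ c) →
      at Λ (λ (x , j) → (k x j - r j) * (k x j - r j)) ≤ c * c
    deviation {c} k r 0≤c k≤c = ℚ.≤-trans
      (mono (mean m) (λ x → ℚ.≤-trans (sum-squares≤dist² (k x) r)
        (*-mono (dist-nonneg (k x) r) 0≤c (k≤c x) (k≤c x))))
      (ℚ.≤-reflexive (𝔼-const m (c * c)))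

    H≤ : at Λ (λ xj → Hf xj * Hf xj) ≤ L * L * (b * b)
    H≤ = begin
      𝔼 m (λ x → sum (λ j → h x j * h x j))
        ≡⟨ at-sum (mean m) (λ x j → h x j * h x j) ⟩
      sum (λ j → 𝔼 m (λ x → h x j * h x j))
        ≡⟨ sum-cong-≗ (λ j → at-cong (mean m) (λ x →
             cong (λ y → y * y) (sym (bias-shift K (λ y → g y j) (q j) x)))) ⟩
      sum (λ j → 𝔼 m (λ x → bias K (λ y → g y j - q j) x * bias K (λ y → g y j - q j) x))
        ≤⟨ mono (∑ꟳ w) (λ j → contracts (λ y → g y j - q j)) ⟩
      sum (λ j → L * L * 𝔼 m (λ x → G (x , j) * G (x , j)))
        ≡⟨ ∑ꟳ w .at-* (L * L) (λ j → 𝔼 m (λ x → G (x , j) * G (x , j))) ⟩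
      L * L * sum (λ j → 𝔼 m (λ x → G (x , j) * G (x , j)))
        ≡⟨ cong (L * L *_) (sym (at-sum (mean m) (λ x j → G (x , j) * G (x , j)))) ⟩
      L * L * at Λ (λ xj → G xj * G xj)
        ≤⟨ *-monoˡ (*-nonneg 0≤L 0≤L) (deviation g q 0≤b g≤b) ⟩
      L * L * (b * b) ∎
      where open ℚ.≤-Reasoning

    S²≤ : S * S ≤ L * (a * b) * (L * (a * b))
    S²≤ = begin
      S * S ≤⟨ cauchy-schwarz Λ F Hf ⟩
      at Λ (λ xj → F xj * F xj) * at Λ (λ xj → Hf xj * Hf xj)
        ≤⟨ *-mono (Λ .nonneg (λ xj → square-nonneg (Hf xj))) (*-nonneg 0≤a 0≤a)
             (deviation f p 0≤a f≤a) H≤ ⟩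
      a * a * (L * L * (b * b)) ≡⟨ lemma L a b ⟩
      L * (a * b) * (L * (a * b)) ∎
      where
      open ℚ.≤-Reasoning
      lemma : ∀ L a b → a * a * (L * L * (b * b)) ≡ L * (a * b) * (L * (a * b))
      lemma = solve-∀ ℚ-ring

  -- Layers of permutations

  Layer : ℕ → Set
  Layer w = Bool → Permutation′ w

  -- The layers applied to a column from the right; `row` applies them to a row from the left. When
  -- two halves are joined, the left one is read by rows and the right one by columns, so that they
  -- meet in one inner product.
  col : ∀ {w n} → Vec (Layer w) n → Bits n → Vector w → Vector w
  col []       []      z = z
  col (ℓ ∷ ls) (b ∷ x) z = col ls x z ∙ ℓ b

  row : ∀ {w n} → Vector w → Vec (Layer w) n → Bits n → Vector w
  row u []       []      = u
  row u (ℓ ∷ ls) (b ∷ x) = row (u ∙ flip (ℓ b)) ls x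

  colMean : ∀ {w n} → Vec (Layer w) n → Vector w → Vector w
  colMean []       z = z
  colMean (ℓ ∷ ls) z = mix (colMean ls z ∙ ℓ false) (colMean ls z ∙ ℓ true)

  rowMean : ∀ {w n} → Vector w → Vec (Layer w) n → Vector w
  rowMean u []       = u
  rowMean u (ℓ ∷ ls) = rowMean (mix (u ∙ flip (ℓ false)) (u ∙ flip (ℓ true))) ls

  colVar : ∀ {w n} → Vec (Layer w) n → Vector w → ℚ
  colVar []       z = 0ℚ
  colVar (ℓ ∷ ls) z = gap (colMean ls z ∙ ℓ false) (colMean ls z ∙ ℓ true) + colVar ls z

  rowVar : ∀ {w n} → Vector w → Vec (Layer w) n → ℚ
  rowVar u []       = 0ℚ
  rowVar u (ℓ ∷ ls) = gap (u ∙ flip (ℓ false)) (u ∙ flip (ℓ true))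
    + rowVar (mix (u ∙ flip (ℓ false)) (u ∙ flip (ℓ true))) ls

  colVar-nonneg : ∀ {w n} (ls : Vec (Layer w) n) z → 0ℚ ≤ colVar ls z
  colVar-nonneg []       z = ℚ.≤-refl
  colVar-nonneg (ℓ ∷ ls) z =
    +-nonneg (gap-nonneg (colMean ls z ∙ ℓ false) (colMean ls z ∙ ℓ true)) (colVar-nonneg ls z)

  rowVar-nonneg : ∀ {w n} u (ls : Vec (Layer w) n) → 0ℚ ≤ rowVar u ls
  rowVar-nonneg u []       = ℚ.≤-refl
  rowVar-nonneg u (ℓ ∷ ls) = +-nonneg (gap-nonneg (u ∙ flip (ℓ false)) (u ∙ flip (ℓ true)))
    (rowVar-nonneg (mix (u ∙ flip (ℓ false)) (u ∙ flip (ℓ true))) ls)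

  -- Each layer pays for its `gap` with a drop of the potential, and the drops telescope. The
  -- potential still left stays in the statement to pay for the next layer.
  colVar+spread : ∀ {w n} (ls : Vec (Layer w) n) z → colVar ls z + spread (colMean ls z) ≤ spread z
  colVar+spread []       z = ℚ.≤-reflexive (ℚ.+-identityˡ (spread z))
  colVar+spread (ℓ ∷ ls) z = begin
    (g + colVar ls z) + spread m        ≡⟨ lemma g (colVar ls z) (spread m) ⟩
    colVar ls z + (spread m + g)
      ≤⟨ ℚ.+-monoʳ-≤ (colVar ls z) (spread-mix (colMean ls z) (ℓ false) (ℓ true)) ⟩
    colVar ls z + spread (colMean ls z) ≤⟨ colVar+spread ls z ⟩
    spread z                            ∎
    where
    open ℚ.≤-Reasoning
    g = gap (colMean ls z ∙ ℓ false) (colMean ls z ∙ ℓ true)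
    m = mix (colMean ls z ∙ ℓ false) (colMean ls z ∙ ℓ true)
    lemma : ∀ a b c → (a + b) + c ≡ b + (c + a)
    lemma = solve-∀ ℚ-ring

  rowVar+spread : ∀ {w n} u (ls : Vec (Layer w) n) → rowVar u ls + spread (rowMean u ls) ≤ spread u
  rowVar+spread u []       = ℚ.≤-reflexive (ℚ.+-identityˡ (spread u))
  rowVar+spread u (ℓ ∷ ls) = begin
    (g + rowVar m ls) + spread (rowMean m ls) ≡⟨ ℚ.+-assoc g (rowVar m ls) (spread (rowMean m ls)) ⟩
    g + (rowVar m ls + spread (rowMean m ls)) ≤⟨ ℚ.+-monoʳ-≤ g (rowVar+spread m ls) ⟩
    g + spread m                              ≡⟨ ℚ.+-comm g (spread m) ⟩
    spread m + g                              ≤⟨ spread-mix u (flip (ℓ false)) (flip (ℓ true)) ⟩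
    spread u                                  ∎
    where
    open ℚ.≤-Reasoning
    g = gap (u ∙ flip (ℓ false)) (u ∙ flip (ℓ true))
    m = mix (u ∙ flip (ℓ false)) (u ∙ flip (ℓ true))

  colVar≤spread : ∀ {w n} (ls : Vec (Layer w) n) z → colVar ls z ≤ spread z
  colVar≤spread ls z = ℚ.≤-trans
    (≤-by (spread (colMean ls z)) refl (spread-nonneg (colMean ls z))) (colVar+spread ls z)

  rowVar≤spread : ∀ {w n} u (ls : Vec (Layer w) n) → rowVar u ls ≤ spread u
  rowVar≤spread u ls = ℚ.≤-trans
    (≤-by (spread (rowMean u ls)) refl (spread-nonneg (rowMean u ls))) (rowVar+spread u ls)

  dist-mix : ∀ {w} (k : Bool → Vector w) b → dist (k b) (mix (k false) (k true)) ≡ gap (k false) (k true)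
  dist-mix k false = dist-mixˡ (k false) (k true)
  dist-mix k true  = dist-mixʳ (k false) (k true)

  -- The detour goes through the mean of the later layers moved by the chosen permutation: the first
  -- leg is the earlier deviation, unchanged by the isometry, and the second is half the distance
  -- between the two branches.
  col-deviation : ∀ {w n} (ls : Vec (Layer w) n) x z → dist (col ls x z) (colMean ls z) ≤ colVar ls z
  col-deviation {w} [] [] z = ℚ.≤-reflexive
    (trans (sum-cong-≗ (λ i → cong ∣_∣ (ℚ.+-inverseʳ (z i)))) (at-0 (∑ꟳ w)))
  col-deviation (ℓ ∷ ls) (b ∷ x) z = begin
    dist (col ls x z ∙ ℓ b) m
      ≤⟨ dist-triangle (col ls x z ∙ ℓ b) (colMean ls z ∙ ℓ b) m ⟩
    dist (col ls x z ∙ ℓ b) (colMean ls z ∙ ℓ b) + dist (colMean ls z ∙ ℓ b) m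
      ≡⟨ cong₂ _+_ (dist-∙ (col ls x z) (colMean ls z) (ℓ b)) (dist-mix (λ b → colMean ls z ∙ ℓ b) b) ⟩
    dist (col ls x z) (colMean ls z) + g ≤⟨ ℚ.+-monoˡ-≤ g (col-deviation ls x z) ⟩
    colVar ls z + g                      ≡⟨ ℚ.+-comm (colVar ls z) g ⟩
    g + colVar ls z                      ∎
    where
    open ℚ.≤-Reasoning
    g = gap (colMean ls z ∙ ℓ false) (colMean ls z ∙ ℓ true)
    m = mix (colMean ls z ∙ ℓ false) (colMean ls z ∙ ℓ true)

  row-isometry : ∀ {w n} p q (ls : Vec (Layer w) n) x → dist (row p ls x) (row q ls x) ≡ dist p q
  row-isometry p q []       []      = refl
  row-isometry p q (ℓ ∷ ls) (b ∷ x) =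
    trans (row-isometry (p ∙ flip (ℓ b)) (q ∙ flip (ℓ b)) ls x) (dist-∙ p q (flip (ℓ b)))

  -- Here averaging happens at the front, so the detour is the same path started from the mean `m`.
  -- The first gap must survive all remaining layers, hence the isometry for whole paths.
  row-deviation : ∀ {w n} u (ls : Vec (Layer w) n) x → dist (row u ls x) (rowMean u ls) ≤ rowVar u ls
  row-deviation {w} u [] [] = ℚ.≤-reflexive
    (trans (sum-cong-≗ (λ i → cong ∣_∣ (ℚ.+-inverseʳ (u i)))) (at-0 (∑ꟳ w)))
  row-deviation u (ℓ ∷ ls) (b ∷ x) = begin
    dist (row uᵇ ls x) (rowMean m ls)
      ≤⟨ dist-triangle (row uᵇ ls x) (row m ls x) (rowMean m ls) ⟩
    dist (row uᵇ ls x) (row m ls x) + dist (row m ls x) (rowMean m ls)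
      ≡⟨ cong (_+ dist (row m ls x) (rowMean m ls))
           (trans (row-isometry uᵇ m ls x) (dist-mix (λ b → u ∙ flip (ℓ b)) b)) ⟩
    g + dist (row m ls x) (rowMean m ls) ≤⟨ ℚ.+-monoʳ-≤ g (row-deviation m ls x) ⟩
    g + rowVar m ls                      ∎
    where
    open ℚ.≤-Reasoning
    uᵇ = u ∙ flip (ℓ b)
    g = gap (u ∙ flip (ℓ false)) (u ∙ flip (ℓ true))
    m = mix (u ∙ flip (ℓ false)) (u ∙ flip (ℓ true))

  row-adjoint : ∀ {w n} u (ls : Vec (Layer w) n) x z → ⟪ row u ls x , z ⟫ ≡ ⟪ u , col ls x z ⟫
  row-adjoint u []       []      z = refl
  row-adjoint u (ℓ ∷ ls) (b ∷ x) z =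
    trans (row-adjoint (u ∙ flip (ℓ b)) ls x z) (adjoint u (col ls x z) (ℓ b))

  ⟪⟫-mixʳ : ∀ {w} (u p q : Vector w) → ⟪ u , mix p q ⟫ ≡ ½ * (⟪ u , p ⟫ + ⟪ u , q ⟫)
  ⟪⟫-mixʳ {w} u p q = trans (sum-cong-≗ (λ i → lemma (u i) (p i) (q i)))
    (trans (∑ꟳ w .at-* ½ (λ i → u i * p i + u i * q i))
           (cong (½ *_) (∑ꟳ w .at-+ (λ i → u i * p i) (λ i → u i * q i))))
    where
    lemma : ∀ a b c → a * (½ * (b + c)) ≡ ½ * (a * b + a * c)
    lemma = solve-∀ ℚ-ring

  ⟪⟫-mixˡ : ∀ {w} (u p q : Vector w) → ⟪ mix p q , u ⟫ ≡ ½ * (⟪ p , u ⟫ + ⟪ q , u ⟫)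
  ⟪⟫-mixˡ u p q = trans (⟪⟫-comm (mix p q) u)
    (trans (⟪⟫-mixʳ u p q) (cong₂ (λ a b → ½ * (a + b)) (⟪⟫-comm u p) (⟪⟫-comm u q)))
    where
    ⟪⟫-comm : ∀ p q → ⟪ p , q ⟫ ≡ ⟪ q , p ⟫
    ⟪⟫-comm p q = sum-cong-≗ (λ i → ℚ.*-comm (p i) (q i))

  rowMean-adjoint : ∀ {w n} u (ls : Vec (Layer w) n) z → ⟪ rowMean u ls , z ⟫ ≡ ⟪ u , colMean ls z ⟫
  rowMean-adjoint u []       z = refl
  rowMean-adjoint u (ℓ ∷ ls) z = begin
    ⟪ rowMean m ls , z ⟫   ≡⟨ rowMean-adjoint m ls z ⟩
    ⟪ m , colMean ls z ⟫   ≡⟨ ⟪⟫-mixˡ (colMean ls z) (u ∙ flip (ℓ false)) (u ∙ flip (ℓ true)) ⟩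
    ½ * (⟪ u ∙ flip (ℓ false) , colMean ls z ⟫ + ⟪ u ∙ flip (ℓ true) , colMean ls z ⟫)
      ≡⟨ cong₂ (λ a b → ½ * (a + b)) (adjoint u (colMean ls z) (ℓ false)) (adjoint u (colMean ls z) (ℓ true)) ⟩
    ½ * (⟪ u , colMean ls z ∙ ℓ false ⟫ + ⟪ u , colMean ls z ∙ ℓ true ⟫)
      ≡⟨ sym (⟪⟫-mixʳ u (colMean ls z ∙ ℓ false) (colMean ls z ∙ ℓ true)) ⟩
    ⟪ u , colMean (ℓ ∷ ls) z ⟫ ∎
    where
    open ≡-Reasoning
    m = mix (u ∙ flip (ℓ false)) (u ∙ flip (ℓ true))

  𝔼-col : ∀ {w n} u (ls : Vec (Layer w) n) z → 𝔼 n (λ x → ⟪ u , col ls x z ⟫) ≡ ⟪ u , colMean ls z ⟫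
  𝔼-col u [] z = 𝔼-zero (λ x → ⟪ u , col [] x z ⟫)
  𝔼-col {n = suc n} u (ℓ ∷ ls) z = begin
    𝔼 (suc n) (λ x → ⟪ u , col (ℓ ∷ ls) x z ⟫)
      ≡⟨ 𝔼-suc n (λ x → ⟪ u , col (ℓ ∷ ls) x z ⟫) ⟩
    ½ * (𝔼 n (λ x → ⟪ u , col ls x z ∙ ℓ false ⟫) + 𝔼 n (λ x → ⟪ u , col ls x z ∙ ℓ true ⟫))
      ≡⟨ cong₂ (λ a b → ½ * (a + b)) (branch false) (branch true) ⟩
    ½ * (⟪ u , colMean ls z ∙ ℓ false ⟫ + ⟪ u , colMean ls z ∙ ℓ true ⟫)
      ≡⟨ sym (⟪⟫-mixʳ u (colMean ls z ∙ ℓ false) (colMean ls z ∙ ℓ true)) ⟩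
    ⟪ u , colMean (ℓ ∷ ls) z ⟫ ∎
    where
    open ≡-Reasoning
    branch : ∀ b → 𝔼 n (λ x → ⟪ u , col ls x z ∙ ℓ b ⟫) ≡ ⟪ u , colMean ls z ∙ ℓ b ⟫
    branch b = trans (at-cong (mean n) (λ x → sym (adjoint u (col ls x z) (ℓ b))))
      (trans (𝔼-col (u ∙ flip (ℓ b)) ls z) (adjoint u (colMean ls z) (ℓ b)))

  col-++ : ∀ {w m n} (ls : Vec (Layer w) m) (rs : Vec (Layer w) n) x y z →
    col (ls ++ rs) (x ++ y) z ≡ col ls x (col rs y z)
  col-++ []       rs []      y z = refl
  col-++ (ℓ ∷ ls) rs (b ∷ x) y z = cong (_∙ ℓ b) (col-++ ls rs x y z)

  colMean-++ : ∀ {w m n} (ls : Vec (Layer w) m) (rs : Vec (Layer w) n) z →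
    colMean (ls ++ rs) z ≡ colMean ls (colMean rs z)
  colMean-++ []       rs z = refl
  colMean-++ (ℓ ∷ ls) rs z = cong (λ v → mix (v ∙ ℓ false) (v ∙ ℓ true)) (colMean-++ ls rs z)

  colVar-++ : ∀ {w m n} (ls : Vec (Layer w) m) (rs : Vec (Layer w) n) z →
    colVar (ls ++ rs) z ≡ colVar ls (colMean rs z) + colVar rs z
  colVar-++ []       rs z = sym (ℚ.+-identityˡ (colVar rs z))
  colVar-++ (ℓ ∷ ls) rs z = trans
    (cong₂ _+_ (cong (λ v → gap (v ∙ ℓ false) (v ∙ ℓ true)) (colMean-++ ls rs z)) (colVar-++ ls rs z))
    (sym (ℚ.+-assoc (gap (v ∙ ℓ false) (v ∙ ℓ true)) (colVar ls (colMean rs z)) (colVar rs z)))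
    where v = colMean ls (colMean rs z)

  rowVar-++ : ∀ {w m n} u (ls : Vec (Layer w) m) (rs : Vec (Layer w) n) →
    rowVar u (ls ++ rs) ≡ rowVar u ls + rowVar (rowMean u ls) rs
  rowVar-++ u []       rs = sym (ℚ.+-identityˡ (rowVar u rs))
  rowVar-++ u (ℓ ∷ ls) rs = trans (cong (g +_) (rowVar-++ m ls rs))
    (sym (ℚ.+-assoc g (rowVar m ls) (rowVar (rowMean m ls) rs)))
    where
    g = gap (u ∙ flip (ℓ false)) (u ∙ flip (ℓ true))
    m = mix (u ∙ flip (ℓ false)) (u ∙ flip (ℓ true))

  ∣sum₄∣≤ : ∀ a b c d → ∣ ((a + b) + c) + d ∣ ≤ ((∣ a ∣ + ∣ b ∣) + ∣ c ∣) + ∣ d ∣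
  ∣sum₄∣≤ a b c d = ℚ.≤-trans (ℚ.∣p+q∣≤∣p∣+∣q∣ ((a + b) + c) d) (ℚ.+-monoˡ-≤ ∣ d ∣
    (ℚ.≤-trans (ℚ.∣p+q∣≤∣p∣+∣q∣ (a + b) c) (ℚ.+-monoˡ-≤ ∣ c ∣ (ℚ.∣p+q∣≤∣p∣+∣q∣ a b))))

  -- The generator

  gen-error : ∀ {w d} (H : ∀ i → RegularGraph (seedLength d i) d) i →
    Vec (Layer w) (2 ℕ.^ i) → Vector w → Vector w → ℚ
  gen-error {d = d} H i ls u z =
    𝔼 (seedLength d i) (λ s → ⟪ u , col ls (gen H i s) z ⟫) - ⟪ u , colMean ls z ⟫

  module _ {w d : ℕ} (H : ∀ i → RegularGraph (seedLength d i) d) (L : ℚ) (0≤L : 0ℚ ≤ L)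
    (L-small : nat 16 * L * (width w * width w * width w) ≤ 1ℚ) where

    private
      W = width w
      2L = (1ℚ + 1ℚ) * L
      0≤2L : 0ℚ ≤ 2L
      0≤2L = *-nonneg (ℚ.nonNegative⁻¹ (1ℚ + 1ℚ)) 0≤L

    -- All `u` and `z` are covered because joining two halves invokes the hypothesis with averaged
    -- vectors and with basis vectors, not only with those of the program.
    Fooled : ∀ i → Vec (Layer w) (2 ℕ.^ i) → Set
    Fooled i ls = ∀ u z → ∣ gen-error H i ls u z ∣ ≤ 2L * (rowVar u ls * colVar ls z)

    module Step (i : ℕ) (contracts : Contracts (H i) L) (l r : Vec (Layer w) (2 ℕ.^ i))
      (fooledˡ : Fooled i l) (fooledʳ : Fooled i r) (u z : Vector w) where

      m = seedLength d i
      u̅ z̅ F G : Vector w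
      f g : Bits m → Vector w
      u̅ = rowMean u l
      z̅ = colMean r z
      f x = row u l (gen H i x)
      g x = col r (gen H i x) z
      F = atᵛ (mean m) f
      G = atᵛ (mean m) g
      a₁ = rowVar u l
      a₂ = rowVar u̅ r
      b₁ = colVar l z̅
      b₂ = colVar r z
      0≤a₁ = rowVar-nonneg u l
      0≤a₂ = rowVar-nonneg u̅ r
      0≤b₁ = colVar-nonneg l z̅
      0≤b₂ = colVar-nonneg r z

      joint : ℚ
      joint = 𝔼 m (λ x → 𝔼 d (λ e → ⟪ f x , g (neighbor (H i) x e) ⟫))

      ls : Vec (Layer w) (2 ℕ.^ suc i)
      ls = l ++ r ++ []

      expectation : 𝔼 (seedLength d (suc i)) (λ s → ⟪ u , col ls (gen H (suc i) s) z ⟫) ≡ joint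
      expectation = trans
        (at-cong (mean (m ℕ.+ d)) (λ s → pointwise (take m s) (drop m s)))
        (𝔼-split m (λ x e → ⟪ f x , g (neighbor (H i) x e) ⟫))
        where
        pointwise : ∀ x e →
          ⟪ u , col ls (gen H i x ++ gen H i (neighbor (H i) x e) ++ []) z ⟫
            ≡ ⟪ f x , g (neighbor (H i) x e) ⟫
        pointwise x e = trans
          (cong (λ v → ⟪ u , v ⟫) (trans
            (col-++ l (r ++ []) (gen H i x) (gen H i x′ ++ []) z)
            (cong (col l (gen H i x)) (col-++ r [] (gen H i x′) [] z))))
          (sym (row-adjoint u l (gen H i x) (g x′)))
          where x′ = neighbor (H i) x e

      truth : ⟪ u , colMean ls z ⟫ ≡ ⟪ u̅ , z̅ ⟫
      truth = trans
        (cong (λ v → ⟪ u , v ⟫) (trans (colMean-++ l (r ++ []) z) (cong (colMean l) (colMean-++ r [] z))))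
        (sym (rowMean-adjoint u l z̅))

      rowVar≡ : rowVar u ls ≡ a₁ + a₂
      rowVar≡ = trans (rowVar-++ u l (r ++ []))
        (cong (a₁ +_) (trans (rowVar-++ u̅ r []) (ℚ.+-identityʳ a₂)))

      colVar≡ : colVar ls z ≡ b₁ + b₂
      colVar≡ = trans (colVar-++ l (r ++ []) z)
        (cong₂ _+_ (cong (colVar l) (colMean-++ r [] z))
                   (trans (colVar-++ r [] z) (ℚ.+-identityʳ b₂)))

      errorˡ : ∀ y → ⟪ F , y ⟫ - ⟪ u̅ , y ⟫ ≡ gen-error H i l u y
      errorˡ y = cong₂ _-_
        (trans (sym (at-⟪⟫ˡ (mean m) f y)) (at-cong (mean m) (λ x → row-adjoint u l (gen H i x) y)))
        (rowMean-adjoint u l y)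

      errorʳ : ∀ v → ⟪ v , G ⟫ - ⟪ v , z̅ ⟫ ≡ gen-error H i r v z
      errorʳ v = cong (_- ⟪ v , z̅ ⟫) (sym (at-⟪⟫ʳ (mean m) v g))

      -- Entry `j` is the error of the left half with `basis j` as its final vector, and `colVar` of
      -- that vector is at most its potential.
      errorˡ-entry : ∀ j → ∣ (F ⊖ u̅) j ∣ ≤ 2L * (a₁ * ((1ℚ + 1ℚ) * W))
      errorˡ-entry j = ℚ.≤-trans
        (ℚ.≤-reflexive (cong ∣_∣ (trans
          (sym (cong₂ _-_ (⟪,basis⟫ F j) (⟪,basis⟫ u̅ j))) (errorˡ (basis j)))))
        (ℚ.≤-trans (fooledˡ u (basis j)) (*-monoˡ 0≤2L (*-monoˡ 0≤a₁
          (ℚ.≤-trans (colVar≤spread l (basis j)) (spread-basis j)))))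

      errorʳ-entry : ∀ j → ∣ (G ⊖ z̅) j ∣ ≤ 2L * (((1ℚ + 1ℚ) * W) * b₂)
      errorʳ-entry j = ℚ.≤-trans
        (ℚ.≤-reflexive (cong ∣_∣ (trans
          (sym (cong₂ _-_ (⟪basis,⟫ j G) (⟪basis,⟫ j z̅))) (errorʳ (basis j)))))
        (ℚ.≤-trans (fooledʳ (basis j) z) (*-monoˡ 0≤2L (*-monoʳ 0≤b₂
          (ℚ.≤-trans (rowVar≤spread (basis j) r) (spread-basis j)))))

      quadratic : ∣ ⟪ F ⊖ u̅ , G ⊖ z̅ ⟫ ∣ ≤ L * (a₁ * b₂)
      quadratic = begin
        ∣ ⟪ F ⊖ u̅ , G ⊖ z̅ ⟫ ∣
          ≤⟨ at-∣∣ (∑ꟳ w) (λ j → (F ⊖ u̅) j * (G ⊖ z̅) j) ⟩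
        sum (λ j → ∣ (F ⊖ u̅) j * (G ⊖ z̅) j ∣)
          ≤⟨ mono (∑ꟳ w) {g = λ _ → A * B} (λ j → ℚ.≤-trans
               (ℚ.≤-reflexive (ℚ.∣p*q∣≡∣p∣*∣q∣ ((F ⊖ u̅) j) ((G ⊖ z̅) j)))
               (*-mono (ℚ.0≤∣p∣ ((G ⊖ z̅) j)) 0≤A (errorˡ-entry j) (errorʳ-entry j))) ⟩
        sum {w} (λ _ → A * B)                    ≡⟨ sum-const w (A * B) ⟩
        A * B * W                                ≡⟨ collect L a₁ b₂ W ⟩
        (nat 16 * L * (W * W * W)) * (L * (a₁ * b₂))
          ≤⟨ *-monoʳ (*-nonneg 0≤L (*-nonneg 0≤a₁ 0≤b₂)) L-small ⟩
        1ℚ * (L * (a₁ * b₂))                     ≡⟨ ℚ.*-identityˡ (L * (a₁ * b₂)) ⟩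
        L * (a₁ * b₂)                            ∎
        where
        open ℚ.≤-Reasoning
        A = 2L * (a₁ * ((1ℚ + 1ℚ) * W))
        B = 2L * (((1ℚ + 1ℚ) * W) * b₂)
        0≤A : 0ℚ ≤ A
        0≤A = *-nonneg 0≤2L (*-nonneg 0≤a₁ (*-nonneg (ℚ.nonNegative⁻¹ (1ℚ + 1ℚ)) (width-nonneg w)))
        collect : ∀ L a b W →
          ((1ℚ + 1ℚ) * L * (a * ((1ℚ + 1ℚ) * W))) * ((1ℚ + 1ℚ) * L * (((1ℚ + 1ℚ) * W) * b)) * W
            ≡ (nat 16 * L * (W * W * W)) * (L * (a * b))
        collect = solve-∀ ℚ-ring

      -- `⟪ F , G ⟫` would be the value with independent seeds. The first term is the cost of
      -- correlating them; the rest expands the pairing bilinearly around `u̅` and `z̅`, where the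
      -- linear terms are the errors of the halves.
      expand : joint - ⟪ u̅ , z̅ ⟫ ≡
        (((joint - ⟪ F , G ⟫) + gen-error H i l u z̅) + gen-error H i r u̅ z) + ⟪ F ⊖ u̅ , G ⊖ z̅ ⟫
      expand = trans (lemma joint ⟪ F , G ⟫ ⟪ F , z̅ ⟫ ⟪ u̅ , G ⟫ ⟪ u̅ , z̅ ⟫)
        (cong₂ _+_ (cong₂ _+_ (cong ((joint - ⟪ F , G ⟫) +_) (errorˡ z̅)) (errorʳ u̅))
          (sym (trans (⟪⟫-⊖ʳ (F ⊖ u̅) G z̅) (cong₂ _-_ (⟪⟫-⊖ˡ G F u̅) (⟪⟫-⊖ˡ z̅ F u̅)))))
        where
        lemma : ∀ j FG Fz uG uz →
          j - uz ≡ (((j - FG) + (Fz - uz)) + (uG - uz)) + ((FG - uG) - (Fz - uz))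
        lemma = solve-∀ ℚ-ring

      fooled : ∣ gen-error H (suc i) ls u z ∣ ≤ 2L * (rowVar u ls * colVar ls z)
      fooled = begin
        ∣ gen-error H (suc i) ls u z ∣ ≡⟨ cong ∣_∣ (trans (cong₂ _-_ expectation truth) expand) ⟩
        ∣ ((e₀ + e₁) + e₂) + e₃ ∣    ≤⟨ ∣sum₄∣≤ e₀ e₁ e₂ e₃ ⟩
        ((∣ e₀ ∣ + ∣ e₁ ∣) + ∣ e₂ ∣) + ∣ e₃ ∣
          ≤⟨ ℚ.+-mono-≤ (ℚ.+-mono-≤ (ℚ.+-mono-≤ expander-error (fooledˡ u z̅)) (fooledʳ u̅ z)) quadratic ⟩
        ((L * (a₁ * b₂) + 2L * (a₁ * b₁)) + 2L * (a₂ * b₂)) + L * (a₁ * b₂)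
          -- The expander term and the quadratic term each cost `L * (a₁ * b₂)`, which explains the
          -- factor 2 in `2L`; the opposite cross term is pure slack.
          ≤⟨ ≤-by (2L * (a₂ * b₁)) (lemma L a₁ a₂ b₁ b₂) (*-nonneg 0≤2L (*-nonneg 0≤a₂ 0≤b₁)) ⟩
        2L * ((a₁ + a₂) * (b₁ + b₂)) ≡⟨ cong₂ (λ a b → 2L * (a * b)) (sym rowVar≡) (sym colVar≡) ⟩
        2L * (rowVar u ls * colVar ls z) ∎
        where
        open ℚ.≤-Reasoning
        e₀ = joint - ⟪ F , G ⟫
        e₁ = gen-error H i l u z̅
        e₂ = gen-error H i r u̅ z
        e₃ = ⟪ F ⊖ u̅ , G ⊖ z̅ ⟫
        expander-error : ∣ e₀ ∣ ≤ L * (a₁ * b₂)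
        expander-error = decorrelate (H i) 0≤L 0≤a₁ 0≤b₂ contracts f g u̅ z̅
          (λ x → row-deviation u l (gen H i x)) (λ x → col-deviation r (gen H i x) z)
        lemma : ∀ L a₁ a₂ b₁ b₂ → (1ℚ + 1ℚ) * L * ((a₁ + a₂) * (b₁ + b₂)) ≡
          (((L * (a₁ * b₂) + (1ℚ + 1ℚ) * L * (a₁ * b₁)) + (1ℚ + 1ℚ) * L * (a₂ * b₂)) + L * (a₁ * b₂))
            + (1ℚ + 1ℚ) * L * (a₂ * b₁)
        lemma = solve-∀ ℚ-ring

    gen-fools : ∀ i → (∀ j → j ℕ.< i → Contracts (H j) L) → ∀ ls → Fooled i ls
    -- The base generator is the identity on one bit, so its error is exactly zero.
    gen-fools zero    contracts ls u z = subst (_≤ 2L * (rowVar u ls * colVar ls z))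
      (sym (cong ∣_∣ (trans (cong (_- ⟪ u , colMean ls z ⟫) (𝔼-col u ls z))
                            (ℚ.+-inverseʳ ⟪ u , colMean ls z ⟫))))
      (*-nonneg 0≤2L (*-nonneg (rowVar-nonneg u ls) (colVar-nonneg ls z)))
    gen-fools (suc i) contracts ls with splitAt (2 ℕ.^ i) ls
    ... | l , rest , refl with splitAt (2 ℕ.^ i) rest
    ...   | r , [] , refl = Step.fooled i (contracts i ℕ.≤-refl) l r (below l) (below r)
      where
      below : ∀ ls → Fooled i ls
      below = gen-fools i (λ j j<i → contracts j (ℕ.m<n⇒m<1+n j<i))

  -- From branching programs to padded sequences of layers

  row-program : ∀ {w n} (M : Fin n → Bool → SqMatrix w) (π : Fin n → Layer w) →
    (∀ t b i j → M t b i j ≡ 𝟙 (does ((π t b ⟨$⟩ʳ i) Fin.≟ j))) →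
    ∀ v u → (∀ j → v j ≡ u j) → ∀ x j → (v ·∏ M [ x ]) j ≡ row u (tabulate π) x j
  row-program M π M≡π v u v≗u []      j = v≗u j
  row-program M π M≡π v u v≗u (b ∷ x) =
    row-program (M ∘ suc) (π ∘ suc) (λ t → M≡π (suc t))
      (λ j → sum (λ i → v i * M zero b i j)) (u ∙ flip (π zero b)) step x
    where
    step : ∀ j → sum (λ i → v i * M zero b i j) ≡ (u ∙ flip (π zero b)) j
    step j = begin
      sum (λ i → v i * M zero b i j)
        ≡⟨ ⟪⟫-cong v≗u (λ i → trans (M≡π zero b i j) (δ-comm (π zero b ⟨$⟩ʳ i) j)) ⟩
      ⟪ u , basis j ∙ π zero b ⟫        ≡⟨ sym (adjoint u (basis j) (π zero b)) ⟩
      ⟪ u ∙ flip (π zero b) , basis j ⟫ ≡⟨ ⟪,basis⟫ (u ∙ flip (π zero b)) j ⟩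
      (u ∙ flip (π zero b)) j           ∎
      where open ≡-Reasoning

  idLayer : ∀ {w} → Layer w
  idLayer _ = idₚ

  row-replicate-id : ∀ {w} N (u : Vector w) x → row u (replicate N idLayer) x ≡ u
  row-replicate-id zero    u []      = refl
  row-replicate-id (suc N) u (b ∷ x) = row-replicate-id N u x

  -- Identity layers ignore their bit, so the padded program reads all of the output of `gen` but
  -- depends only on the prefix that `INW` keeps.
  row-padRight : ∀ {w n N} (n≤N : n ℕ.≤ N) u (ls : Vec (Layer w) n) x →
    row u (padRight n≤N idLayer ls) x ≡ row u ls (truncate n≤N x)
  row-padRight ℕ.z≤n         u []       x       = row-replicate-id _ u x
  row-padRight (ℕ.s≤s n≤N) u (ℓ ∷ ls) (b ∷ x) = row-padRight n≤N (u ∙ flip (ℓ b)) ls x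

  mix-self : ∀ p → ½ * (p + p) ≡ p
  mix-self = solve-∀ ℚ-ring

  colMean-replicate-id : ∀ {w} N (z : Vector w) i → colMean (replicate N idLayer) z i ≡ z i
  colMean-replicate-id zero    z i = refl
  colMean-replicate-id (suc N) z i =
    trans (mix-self (colMean (replicate N idLayer) z i)) (colMean-replicate-id N z i)

  colMean-padRight : ∀ {w n N} (n≤N : n ℕ.≤ N) (ls : Vec (Layer w) n) z i →
    colMean (padRight n≤N idLayer ls) z i ≡ colMean ls z i
  colMean-padRight {N = N} ℕ.z≤n         []       z i = colMean-replicate-id N z i
  colMean-padRight (ℕ.s≤s n≤N) (ℓ ∷ ls) z i = cong₂ (λ a b → ½ * (a + b))
    (colMean-padRight n≤N ls z (ℓ false ⟨$⟩ʳ i)) (colMean-padRight n≤N ls z (ℓ true ⟨$⟩ʳ i))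

  INW-error : ∀ {w d} n (H : ∀ i → RegularGraph (seedLength d i) d) L → 0ℚ ≤ L →
    nat 16 * L * (width w * width w * width w) ≤ 1ℚ →
    (∀ i → i ℕ.< ⌈log₂ n ⌉ → Contracts (H i) L) →
    (P : BranchingProgram w n) → IsPermutationProgram P →
    ∣ 𝔼 n (value P) - 𝔼 (seedLength d ⌈log₂ n ⌉) (value P ∘ INW n H) ∣
      ≤ nat 4 * L * (width w * width w * width w)
  INW-error {w} {d} n H L 0≤L L-small contracts P perm = begin
    ∣ 𝔼 n (value P) - 𝔼 (seedLength d h) (value P ∘ INW n H) ∣
      ≡⟨ ∣-∣-swap (𝔼 n (value P)) (𝔼 (seedLength d h) (value P ∘ INW n H)) ⟩
    ∣ 𝔼 (seedLength d h) (value P ∘ INW n H) - 𝔼 n (value P) ∣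
      ≡⟨ cong ∣_∣ (cong₂ _-_ pseudorandom uniform) ⟩
    ∣ gen-error H h padded u z ∣
      ≤⟨ gen-fools H L 0≤L L-small h contracts padded u z ⟩
    (1ℚ + 1ℚ) * L * (rowVar u padded * colVar padded z)
      ≤⟨ *-monoˡ (*-nonneg (ℚ.nonNegative⁻¹ (1ℚ + 1ℚ)) 0≤L)
           (*-mono (colVar-nonneg padded z) (*-nonneg (ℚ.nonNegative⁻¹ (1ℚ + 1ℚ)) (width-nonneg w))
             (ℚ.≤-trans (rowVar≤spread u padded) (spread-basis source))
             (ℚ.≤-trans (colVar≤spread padded z) (spread-indicator (lookup accept)))) ⟩
    (1ℚ + 1ℚ) * L * (((1ℚ + 1ℚ) * W) * (W * W)) ≡⟨ collect L W ⟩
    nat 4 * L * (W * W * W) ∎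
    where
    open ℚ.≤-Reasoning
    open BranchingProgram P using (accept) renaming (start to source)
    W = width w
    h = ⌈log₂ n ⌉
    u = basis source
    z = 𝟙 ∘ lookup accept
    layers : Vec (Layer w) n
    layers = tabulate (λ t b → proj₁ (perm t b))
    padded : Vec (Layer w) (2 ℕ.^ h)
    padded = padRight (n≤2^⌈log₂n⌉ n) idLayer layers
    collect : ∀ L W → (1ℚ + 1ℚ) * L * (((1ℚ + 1ℚ) * W) * (W * W)) ≡ nat 4 * L * (W * W * W)
    collect = solve-∀ ℚ-ring
    value-row : ∀ x → value P x ≡ ⟪ row u layers x , z ⟫
    value-row x = ⟪⟫-cong
      (row-program (edgeMatrix P) (λ t b → proj₁ (perm t b)) (λ t b → proj₂ (perm t b)) u u (λ _ → refl) x)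
      (λ _ → refl)
    uniform : 𝔼 n (value P) ≡ ⟪ u , colMean padded z ⟫
    uniform = trans
      (at-cong (mean n) (λ x → trans (value-row x) (row-adjoint u layers x z)))
      (trans (𝔼-col u layers z)
        (⟪⟫-cong {u = u} (λ _ → refl) (λ i → sym (colMean-padRight (n≤2^⌈log₂n⌉ n) layers z i))))
    pseudorandom : 𝔼 (seedLength d h) (value P ∘ INW n H) ≡
      𝔼 (seedLength d h) (λ s → ⟪ u , col padded (gen H h s) z ⟫)
    pseudorandom = at-cong (mean (seedLength d h)) (λ s → trans (value-row (INW n H s))
      (trans (cong (λ v → ⟪ v , z ⟫) (sym (row-padRight (n≤2^⌈log₂n⌉ n) u layers (gen H h s))))
             (row-adjoint u padded (gen H h s) z)))

  -- From rational estimates to Cauchy reals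

  Eventually : (ℕ → Set) → Set
  Eventually P = ∃[ N ] ∀ k → N ℕ.≤ k → P k

  eventually-∧ : ∀ {P Q} → Eventually P → Eventually Q → Eventually (λ k → P k × Q k)
  eventually-∧ (M , p) (N , q) = M ℕ.⊔ N , λ k k≥ →
    p k (ℕ.m⊔n≤o⇒m≤o M N k≥) , q k (ℕ.m⊔n≤o⇒n≤o M N k≥)

  eventually-map : ∀ {P Q} → (∀ k → P k → Q k) → Eventually P → Eventually Q
  eventually-map f (N , p) = N , λ k N≤k → f k (p k N≤k)

  p+δ-mono : ∀ {p q δ} → 0ℚ < δ → p ≤ q → p ≤ q + δ
  p+δ-mono {p} {q} {δ} 0<δ p≤q = ℚ.≤-trans p≤q (≤-by δ refl (ℚ.<⇒≤ 0<δ))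

  width≡nat : ∀ w → width w ≡ nat w
  width≡nat zero    = refl
  width≡nat (suc w) = trans (cong (1ℚ +_) (width≡nat w)) (sym (nat-+ 1 w))

  0<½ : 0ℚ < ½
  0<½ = ℚ.positive⁻¹ ½

  0<¼ : 0ℚ < ¼
  0<¼ = ℚ.positive⁻¹ ¼

  eventually-positive : ∀ {x} → 0ᴿ <ᴿ x → ∃[ δ ] 0ℚ < δ × Eventually (λ k → δ ≤ seq x k)
  eventually-positive {x} (δ , 0<δ , 0<x) =
    δ , 0<δ , eventually-map (λ k → subst (_≤ seq x k) (ℚ.+-identityˡ δ)) 0<x

  ∣p-q∣≤⇒p≤q+ : ∀ {p q δ} → ∣ p - q ∣ ≤ δ → p ≤ q + δ
  ∣p-q∣≤⇒p≤q+ {p} {q} {δ} h = subst (_≤ q + δ) (lemma p q)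
    (ℚ.+-monoʳ-≤ q (ℚ.≤-trans (p≤∣p∣ (p - q)) h))
    where
    lemma : ∀ p q → q + (p - q) ≡ p
    lemma = solve-∀ ℚ-ring

  module Scale (w : ℕ) .{{_ : ℕ.NonZero w}} where

    instance
      w³≢0 : ℕ.NonZero (w ℕ.^ 3)
      w³≢0 = ℕ.m^n≢0 w 3
      32w³≢0 : ℕ.NonZero (32 ℕ.* w ℕ.^ 3)
      32w³≢0 = ℕ.m*n≢0 32 (w ℕ.^ 3)

    σ : ℚ
    σ = recip (32 ℕ.* w ℕ.^ 3)

    0≤σ : 0ℚ ≤ σ
    0≤σ = recip-nonneg (32 ℕ.* w ℕ.^ 3)

    σ-inverse : σ * nat (32 ℕ.* w ℕ.^ 3) ≡ 1ℚ
    σ-inverse = recip-* (32 ℕ.* w ℕ.^ 3)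

    seq-inwλ : ∀ ε k → seq (inwλ ε w) k ≡ seq ε k * σ
    seq-inwλ ε k = refl

    nat-32w³ : nat (32 ℕ.* w ℕ.^ 3) ≡ nat 32 * (width w * width w * width w)
    nat-32w³ = begin
      nat (32 ℕ.* w ℕ.^ 3)                   ≡⟨ nat-* 32 (w ℕ.^ 3) ⟩
      nat 32 * nat (w ℕ.^ 3)
        ≡⟨ cong (nat 32 *_) (trans (nat-* w (w ℕ.^ 2)) (cong (nat w *_)
             (trans (nat-* w (w ℕ.^ 1)) (cong (nat w *_) (nat-* w 1))))) ⟩
      nat 32 * (nat w * (nat w * (nat w * 1ℚ))) ≡⟨ lemma (nat w) ⟩
      nat 32 * (nat w * nat w * nat w)
        ≡⟨ cong (λ W → nat 32 * (W * W * W)) (sym (width≡nat w)) ⟩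
      nat 32 * (width w * width w * width w) ∎
      where
      open ≡-Reasoning
      lemma : ∀ W → nat 32 * (W * (W * (W * 1ℚ))) ≡ nat 32 * (W * W * W)
      lemma = solve-∀ ℚ-ring

    -- The 32 w³ in λ cancels against the cubic factor. With `c` equal to ½ or 1/8, `nat 32 * c`
    -- evaluates to the 16 of the smallness condition or the 4 of the final error.
    σ-scale : ∀ c ρ → nat 32 * c * (ρ * σ) * (width w * width w * width w) ≡ c * ρ
    σ-scale c ρ = begin
      nat 32 * c * (ρ * σ) * W³ ≡⟨ rearrange c ρ σ W³ ⟩
      c * ρ * (σ * (nat 32 * W³)) ≡⟨ cong (λ x → c * ρ * (σ * x)) (sym nat-32w³) ⟩
      c * ρ * (σ * nat (32 ℕ.* w ℕ.^ 3)) ≡⟨ cong (c * ρ *_) σ-inverse ⟩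
      c * ρ * 1ℚ ≡⟨ ℚ.*-identityʳ (c * ρ) ⟩
      c * ρ ∎
      where
      open ≡-Reasoning
      W³ = width w * width w * width w
      rearrange : ∀ c ρ σ W³ → nat 32 * c * (ρ * σ) * W³ ≡ c * ρ * (σ * (nat 32 * W³))
      rearrange = solve-∀ ℚ-ring

    32σ≤1 : nat 32 * σ ≤ 1ℚ
    32σ≤1 = begin
      nat 32 * σ ≡⟨ ℚ.*-comm (nat 32) σ ⟩
      σ * nat 32 ≤⟨ *-monoˡ 0≤σ (nat-mono (ℕ.m≤m*n 32 (w ℕ.^ 3))) ⟩
      σ * nat (32 ℕ.* w ℕ.^ 3) ≡⟨ σ-inverse ⟩
      1ℚ ∎
      where open ℚ.≤-Reasoning

  module _ {n w d : ℕ} .{{_ : ℕ.NonZero w}} {ε : ℝ} (0<ε : 0ᴿ <ᴿ ε) (ε≤1 : ε ≤ᴿ 1ᴿ)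
    (H : ∀ i → RegularGraph (seedLength d i) d)
    (expander : ∀ i → i ℕ.< ⌈log₂ n ⌉ → IsExpander (inwλ ε w) (H i)) where

    open Scale w

    -- One late sample `e` of ε is frozen. Positivity of ε gives a rational lower bound `δ`, and
    -- beyond `N` the sequence moves by less than a quarter of it, so `e` and every later term agree
    -- up to the factor 5/4 in either direction.
    INW-fools : IsPRG ε w n (seedLength d ⌈log₂ n ⌉) (INW n H)
    INW-fools P perm = λ η 0<η → N , λ k N≤k → p+δ-mono 0<η (ℚ.≤-trans error (close k N≤k))
      where
      δ = proj₁ (eventually-positive {ε} 0<ε)
      0<δ = proj₁ (proj₂ (eventually-positive {ε} 0<ε))
      0≤δ = ℚ.<⇒≤ 0<δ
      0<¼δ : 0ℚ < ¼ * δ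
      0<¼δ = ℚ.positive⁻¹ (¼ * δ) {{ℚ.pos*pos⇒pos ¼ δ {{positive 0<δ}}}}
      N₁ = proj₁ (cauchy ε (¼ * δ) 0<¼δ)
      bounds : Eventually (λ k → (N₁ ℕ.≤ k × seq ε k ≤ 1ℚ + ½) × δ ≤ seq ε k)
      bounds = eventually-∧ (eventually-∧ (N₁ , λ k N₁≤k → N₁≤k) (ε≤1 ½ 0<½))
        (proj₂ (proj₂ (eventually-positive {ε} 0<ε)))
      N = proj₁ bounds
      N₁≤ : ∀ {k} → N ℕ.≤ k → N₁ ℕ.≤ k
      N₁≤ N≤k = proj₁ (proj₁ (proj₂ bounds _ N≤k))
      δ≤ε : ∀ {k} → N ℕ.≤ k → δ ≤ seq ε k
      δ≤ε N≤k = proj₂ (proj₂ bounds _ N≤k)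
      near : ∀ {j k} → N ℕ.≤ j → N ℕ.≤ k → ∣ seq ε j - seq ε k ∣ < ¼ * δ
      near N≤j N≤k = proj₂ (cauchy ε (¼ * δ) 0<¼δ) _ _ (N₁≤ N≤j) (N₁≤ N≤k)
      e = seq ε N
      ρ = (1ℚ + ¼) * e
      -- The slack factor 1 + ¼ in ρ makes the real ε / (32 w³) eventually smaller than L.
      L = ρ * σ
      δ≤e = δ≤ε ℕ.≤-refl
      0≤ρ : 0ℚ ≤ ρ
      0≤ρ = *-nonneg (ℚ.nonNegative⁻¹ (1ℚ + ¼)) (ℚ.≤-trans 0≤δ δ≤e)
      0≤L = *-nonneg 0≤ρ 0≤σ
      within : ∀ {p q} → ∣ p - q ∣ < ¼ * δ → δ ≤ q → p ≤ (1ℚ + ¼) * q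
      within {p} {q} h δ≤q = ℚ.≤-trans (∣p-q∣≤⇒p≤q+ (ℚ.<⇒≤ h))
        (ℚ.≤-trans (ℚ.+-monoʳ-≤ q (*-monoˡ (ℚ.<⇒≤ 0<¼) δ≤q)) (ℚ.≤-reflexive (lemma q)))
        where
        lemma : ∀ q → q + ¼ * q ≡ (1ℚ + ¼) * q
        lemma = solve-∀ ℚ-ring
      eventually-λ : EventuallyWithin (inwλ ε w) L
      eventually-λ = N , λ k N≤k → subst (λ x → 0ℚ ≤ x × x ≤ L) (sym (seq-inwλ ε k))
        ( *-nonneg (ℚ.≤-trans 0≤δ (δ≤ε N≤k)) 0≤σ
        , *-monoʳ 0≤σ (within {seq ε k} (near N≤k ℕ.≤-refl) δ≤e))
      L-small : nat 16 * L * (width w * width w * width w) ≤ 1ℚ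
      L-small = begin
        nat 16 * L * (width w * width w * width w) ≡⟨ σ-scale ½ ρ ⟩
        ½ * ((1ℚ + ¼) * e)
          ≤⟨ *-monoˡ 0≤½ (*-monoˡ (ℚ.nonNegative⁻¹ (1ℚ + ¼)) (proj₂ (proj₁ (proj₂ bounds N ℕ.≤-refl)))) ⟩
        -- The bound 3/2 on `e` comes from ε ≤ 1 with tolerance ½; the product is 15/16.
        ½ * ((1ℚ + ¼) * (1ℚ + ½)) ≤⟨ ≤-by (¼ * ¼) refl (ℚ.nonNegative⁻¹ (¼ * ¼)) ⟩
        1ℚ ∎
        where open ℚ.≤-Reasoning
      error : ∣ 𝔼 n (value P) - 𝔼 (seedLength d ⌈log₂ n ⌉) (value P ∘ INW n H) ∣ ≤ ¼ * ½ * ρ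
      error = ℚ.≤-trans
        (INW-error n H L 0≤L L-small
          (λ i i<h → expander-contracts (H i) {inwλ ε w} (expander i i<h) eventually-λ) P perm)
        (ℚ.≤-reflexive (σ-scale (¼ * ½) ρ))
      close : ∀ k → N ℕ.≤ k → ¼ * ½ * ρ ≤ seq ε k
      close k N≤k = begin
        ¼ * ½ * ((1ℚ + ¼) * e)
          ≤⟨ *-monoˡ (ℚ.nonNegative⁻¹ (¼ * ½)) (*-monoˡ (ℚ.nonNegative⁻¹ (1ℚ + ¼))
               (within {e} (near ℕ.≤-refl N≤k) δ≤εₖ)) ⟩
        ¼ * ½ * ((1ℚ + ¼) * ((1ℚ + ¼) * seq ε k))
          -- Two factors 5/4, one inside `L` and one between the samples, against 1/8: the total
          -- 25/128 is below 1.
          ≤⟨ ≤-by (r * seq ε k) (lemma (seq ε k)) (*-nonneg (ℚ.nonNegative⁻¹ r) (ℚ.≤-trans 0≤δ δ≤εₖ)) ⟩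
        seq ε k ∎
        where
        open ℚ.≤-Reasoning
        δ≤εₖ = δ≤ε N≤k
        r = 1ℚ - ¼ * ½ * ((1ℚ + ¼) * (1ℚ + ¼))
        lemma : ∀ x → x ≡ ¼ * ½ * ((1ℚ + ¼) * ((1ℚ + ¼) * x)) + (1ℚ - ¼ * ½ * ((1ℚ + ¼) * (1ℚ + ¼))) * x
        lemma = solve-∀ ℚ-ring

  -- Logarithms and the seed length

  module _ {x ℓ : ℝ} (log : IsLog₂ x ℓ) (a b : ℕ) where

    private
      linear : ∀ k → seq (fromℕ b +ᴿ fromℕ 1 *ᴿ ℓ) k ≡ nat b + seq ℓ k
      linear k = cong (nat b +_) (ℚ.*-identityˡ (seq ℓ k))

      first : ∀ k → nat (2 ℕ.^ b) * (seq x k * 1ℚ) ≡ nat (2 ℕ.^ b) * seq x k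
      first k = cong (nat (2 ℕ.^ b) *_) (ℚ.*-identityʳ (seq x k))

    -- The defining equivalence of `IsLog₂` at denominator 1. The offset `b` brings logarithms of
    -- numbers below 1 within reach of a natural `a`.
    log₂-lower : (∀ δ → 0ℚ < δ → Eventually (λ k → nat (2 ℕ.^ a) ≤ nat (2 ℕ.^ b) * seq x k + δ)) →
      ∀ δ → 0ℚ < δ → Eventually (λ k → nat a ≤ nat b + seq ℓ k + δ)
    log₂-lower h δ 0<δ = eventually-map (λ k → subst (λ p → nat a ≤ p + δ) (linear k))
      (Equivalence.to (proj₁ (log a b 1))
        (λ δ 0<δ → eventually-map (λ k → subst (λ p → nat (2 ℕ.^ a) ≤ p + δ) (sym (first k))) (h δ 0<δ))
        δ 0<δ)

    log₂-lower⁻¹ : (∀ δ → 0ℚ < δ → Eventually (λ k → nat a ≤ nat b + seq ℓ k + δ)) →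
      ∀ δ → 0ℚ < δ → Eventually (λ k → nat (2 ℕ.^ a) ≤ nat (2 ℕ.^ b) * seq x k + δ)
    log₂-lower⁻¹ h δ 0<δ = eventually-map (λ k → subst (λ p → nat (2 ℕ.^ a) ≤ p + δ) (first k))
      (Equivalence.from (proj₁ (log a b 1))
        (λ δ 0<δ → eventually-map (λ k → subst (λ p → nat a ≤ p + δ) (sym (linear k))) (h δ 0<δ))
        δ 0<δ)

    log₂-upper : (∀ δ → 0ℚ < δ → Eventually (λ k → nat (2 ℕ.^ b) * seq x k ≤ nat (2 ℕ.^ a) + δ)) →
      ∀ δ → 0ℚ < δ → Eventually (λ k → nat b + seq ℓ k ≤ nat a + δ)
    log₂-upper h δ 0<δ = eventually-map (λ k → subst (_≤ nat a + δ) (linear k))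
      (Equivalence.to (proj₂ (log a b 1))
        (λ δ 0<δ → eventually-map (λ k → subst (_≤ nat (2 ℕ.^ a) + δ) (sym (first k))) (h δ 0<δ))
        δ 0<δ)

  always : ∀ {p q} → p ≤ q → ∀ δ → 0ℚ < δ → Eventually (λ k → p ≤ q + δ)
  always p≤q δ 0<δ = 0 , λ k _ → p+δ-mono 0<δ p≤q

  2^⌈log₂n⌉∸1≤n : ∀ n → 1 ℕ.≤ n → 2 ℕ.^ (⌈log₂ n ⌉ ℕ.∸ 1) ℕ.≤ n
  2^⌈log₂n⌉∸1≤n n 1≤n with ⌈log₂ n ⌉ in eq
  ... | zero  = 1≤n
  ... | suc h with ℕ.≤-total (2 ℕ.^ h) n
  ...   | inj₁ 2^h≤n = 2^h≤n
  ...   | inj₂ n≤2^h = contradiction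
    (subst₂ ℕ._≤_ eq (⌈log₂2^n⌉≡n h) (⌈log₂⌉-mono-≤ n≤2^h)) ℕ.1+n≰n

  module _ {n : ℕ} (2≤n : 2 ℕ.≤ n) {ℓ : ℝ} (log : IsLog₂ (fromℕ n) ℓ) where

    -- The logarithm is at least 1, but terms of its sequence satisfy this only up to a tolerance,
    -- here ½.
    ½≤log : Eventually (λ k → ½ ≤ seq ℓ k)
    ½≤log = eventually-map (λ k 1≤ → ≤-by ((nat 0 + seq ℓ k + ½) - 1ℚ) (lemma (seq ℓ k)) (0≤q-p 1≤))
      (log₂-lower {fromℕ n} {ℓ} log 1 0 (always (subst (nat 2 ≤_) (sym (ℚ.*-identityˡ (nat n))) (nat-mono 2≤n)))
        ½ 0<½)
      where
      lemma : ∀ x → x ≡ ½ + ((nat 0 + x + ½) - 1ℚ)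
      lemma = solve-∀ ℚ-ring

    -- Rounding up costs 1 and the tolerance ½; both are absorbed by three further copies of a
    -- quantity that is at least ½.
    ⌈log₂⌉≤4log : Eventually (λ k → nat ⌈log₂ n ⌉ ≤ nat 4 * seq ℓ k)
    ⌈log₂⌉≤4log = eventually-map (λ k (½≤ , h≤) → bound (seq ℓ k) ½≤ h≤) (eventually-∧ ½≤log
      (log₂-lower {fromℕ n} {ℓ} log (⌈log₂ n ⌉ ℕ.∸ 1) 0
        (always (subst (nat (2 ℕ.^ (⌈log₂ n ⌉ ℕ.∸ 1)) ≤_) (sym (ℚ.*-identityˡ (nat n)))
          (nat-mono (2^⌈log₂n⌉∸1≤n n (ℕ.<⇒≤ 2≤n)))))
        ½ 0<½))
      where
      h = ⌈log₂ n ⌉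
      lemma : ∀ x → nat 4 * x ≡ (1ℚ + (nat 0 + x + ½)) + nat 3 * (x - ½)
      lemma = solve-∀ ℚ-ring
      bound : ∀ x → ½ ≤ x → nat (h ℕ.∸ 1) ≤ nat 0 + x + ½ → nat h ≤ nat 4 * x
      bound x ½≤x h∸1≤ = begin
        nat h                       ≤⟨ nat-mono (ℕ.m≤n+m∸n h 1) ⟩
        nat (1 ℕ.+ (h ℕ.∸ 1))       ≡⟨ nat-+ 1 (h ℕ.∸ 1) ⟩
        1ℚ + nat (h ℕ.∸ 1)          ≤⟨ ℚ.+-monoʳ-≤ 1ℚ h∸1≤ ⟩
        1ℚ + (nat 0 + x + ½)
          ≤⟨ ≤-by (nat 3 * (x - ½)) (lemma x) (*-nonneg (nat-nonneg 3) (0≤q-p ½≤x)) ⟩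
        nat 4 * x                   ∎
        where open ℚ.≤-Reasoning

  archimedean : ∀ q → ∃[ N ] q ≤ nat N
  archimedean q@(mkℚ (ℤ.+ m) d _) = m , ℚ.toℚᵘ-cancel-≤ (ℚᵘ.≤-respʳ-≃ (ℚᵘ.≃-sym (toℚᵘ-/ (ℤ.+ m) 0))
    (ℚᵘ.*≤* (ℤ.*-monoˡ-≤-nonNeg (ℤ.+ m) (ℤ.+≤+ (ℕ.s≤s ℕ.z≤n)))))
  archimedean q@(mkℚ ℤ.-[1+ m ] d _) = 0 , ℚ.<⇒≤ (ℚ.negative⁻¹ q)

  ceiling : ∀ q → 0ℚ ≤ q → ∃[ a ] q ≤ nat a × nat a ≤ q + 1ℚ
  ceiling q 0≤q = search (proj₁ (archimedean q)) (proj₂ (archimedean q))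
    where
    search : ∀ N → q ≤ nat N → ∃[ a ] q ≤ nat a × nat a ≤ q + 1ℚ
    search zero    q≤0 = 0 , q≤0 , ℚ.≤-trans 0≤q (≤-by 1ℚ refl (ℚ.nonNegative⁻¹ 1ℚ))
    search (suc N) q≤N+1 with ℚ.≤-total q (nat N)
    ... | inj₁ q≤N = search N q≤N
    ... | inj₂ N≤q = suc N , q≤N+1 , (begin
      nat (suc N)  ≡⟨ nat-+ 1 N ⟩
      1ℚ + nat N   ≡⟨ ℚ.+-comm 1ℚ (nat N) ⟩
      nat N + 1ℚ   ≤⟨ ℚ.+-monoˡ-≤ 1ℚ N≤q ⟩
      q + 1ℚ       ∎)
      where open ℚ.≤-Reasoning

  -- Additive constants become multiplicative: the ½ in the bound on `d` is at most `ℓ`, and the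
  -- seed's extra bit is at most `4 ℓ logn`.
  seedLength-bound : ∀ {d c h} {ℓ logn : ℚ} → ½ ≤ ℓ → ½ ≤ logn → nat h ≤ nat 4 * logn →
    nat d ≤ nat c * ℓ + ½ → nat (seedLength d h) ≤ nat (4 ℕ.* c ℕ.+ 8) * (ℓ * logn)
  seedLength-bound {d} {c} {h} {ℓ} {logn} ½≤ℓ ½≤logn h≤ d≤ = begin
    nat (seedLength d h)              ≡⟨ cong nat (seedLength-closed d h) ⟩
    nat (h ℕ.* d ℕ.+ 1)               ≡⟨ trans (nat-+ (h ℕ.* d) 1) (cong (_+ 1ℚ) (nat-* h d)) ⟩
    nat h * nat d + 1ℚ
      ≤⟨ ℚ.+-mono-≤ (*-mono (nat-nonneg d) 0≤4logn h≤ (ℚ.≤-trans d≤ (ℚ.+-monoʳ-≤ (nat c * ℓ) ½≤ℓ)))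
           (*-monoˡ (nat-nonneg 4) (*-mono 0≤½ 0≤ℓ ½≤ℓ ½≤logn)) ⟩
    (nat 4 * logn) * (nat c * ℓ + ℓ) + nat 4 * (ℓ * logn) ≡⟨ lemma (nat c) ℓ logn ⟩
    (nat 4 * nat c + nat 8) * (ℓ * logn)
      ≡⟨ cong (_* (ℓ * logn)) (sym (trans (nat-+ (4 ℕ.* c) 8) (cong (_+ nat 8) (nat-* 4 c)))) ⟩
    nat (4 ℕ.* c ℕ.+ 8) * (ℓ * logn) ∎
    where
    open ℚ.≤-Reasoning
    0≤ℓ = ℚ.≤-trans 0≤½ ½≤ℓ
    0≤4logn : 0ℚ ≤ nat 4 * logn
    0≤4logn = *-nonneg (nat-nonneg 4) (ℚ.≤-trans 0≤½ ½≤logn)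
    lemma : ∀ c ℓ n → (nat 4 * n) * (c * ℓ + ℓ) + nat 4 * (ℓ * n) ≡ (nat 4 * c + nat 8) * (ℓ * n)
    lemma = solve-∀ ℚ-ring

  -- The factor 64 is the price of replacing log(1/λ) by log(1/ε) + log w, so that one constant
  -- serves both bounds.
  seedConstant : ℕ → ℕ
  seedConstant c = (4 ℕ.* c ℕ.+ 8) ℕ.* 64

  coarsen : ∀ {c S ℓ logn x} → ½ ≤ logn → S ≤ nat (4 ℕ.* c ℕ.+ 8) * (ℓ * logn) →
    ℓ ≤ nat 64 * x → S ≤ nat (seedConstant c) * (x * logn)
  coarsen {c} {S} {ℓ} {logn} {x} ½≤logn S≤ ℓ≤ = begin
    S                              ≤⟨ S≤ ⟩
    nat C₀ * (ℓ * logn)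
      ≤⟨ *-monoˡ (nat-nonneg C₀) (*-monoʳ (ℚ.≤-trans 0≤½ ½≤logn) ℓ≤) ⟩
    nat C₀ * (nat 64 * x * logn)   ≡⟨ lemma (nat C₀) x logn ⟩
    (nat C₀ * nat 64) * (x * logn) ≡⟨ cong (_* (x * logn)) (sym (nat-* C₀ 64)) ⟩
    nat (seedConstant c) * (x * logn) ∎
    where
    open ℚ.≤-Reasoning
    C₀ = 4 ℕ.* c ℕ.+ 8
    lemma : ∀ c x y → c * (nat 64 * x * y) ≡ (c * nat 64) * (x * y)
    lemma = solve-∀ ℚ-ring

  module Logs {w : ℕ} .{{_ : ℕ.NonZero w}} {ε λ′ ℓ : ℝ} (0<ε : 0ᴿ <ᴿ ε) (ε≤1 : ε ≤ᴿ 1ᴿ)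
    (seq-λ′ : ∀ k → seq λ′ k ≡ seq ε k * Scale.σ w) (log-λ : IsLog₂[1/ λ′ ] ℓ) where

    open Scale w

    -- Since ε is eventually at most 2 and 32σ at most 1, `2λ` is at most 1; hence log(1/λ) is at
    -- least 1, and ½ goes to the tolerance.
    ½≤log[1/λ] : Eventually (λ k → ½ ≤ seq ℓ k)
    ½≤log[1/λ] = eventually-map
      (λ k 1-ℓ≤ → ≤-by ((nat 0 + ½) - (nat 1 + - seq ℓ k)) (lemma (seq ℓ k)) (0≤q-p 1-ℓ≤))
      (log₂-upper {λ′} { -ᴿ ℓ} log-λ 0 1
        (λ δ 0<δ → eventually-map (λ k ε≤ → p+δ-mono 0<δ
          (subst (λ x → nat 2 * x ≤ nat 1) (sym (seq-λ′ k)) (small (seq ε k) ε≤))) (ε≤1 1ℚ 0<1)) ½ 0<½)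
      where
      0<1 : 0ℚ < 1ℚ
      0<1 = ℚ.positive⁻¹ 1ℚ
      lemma : ∀ x → x ≡ ½ + ((nat 0 + ½) - (nat 1 + - x))
      lemma = solve-∀ ℚ-ring
      small : ∀ e → e ≤ 1ℚ + 1ℚ → nat 2 * (e * σ) ≤ nat 1
      small e e≤2 = begin
        nat 2 * (e * σ)         ≤⟨ *-monoˡ (nat-nonneg 2) (*-monoʳ 0≤σ e≤2) ⟩
        nat 2 * ((1ℚ + 1ℚ) * σ) ≤⟨ ≤-by (nat 28 * σ) (slack σ) (*-nonneg (nat-nonneg 28) 0≤σ) ⟩
        nat 32 * σ              ≤⟨ 32σ≤1 ⟩
        1ℚ                      ∎
        where
        open ℚ.≤-Reasoning
        slack : ∀ s → nat 32 * s ≡ nat 2 * ((1ℚ + 1ℚ) * s) + nat 28 * s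
        slack = solve-∀ ℚ-ring

    module _ {E W : ℝ} (2≤w : 2 ℕ.≤ w) (log-ε : IsLog₂[1/ ε ] E) (log-w : IsLog₂ (fromℕ w) W) where

      private
        h = ⌈log₂ w ⌉

      -- For ε = 1 this logarithm is 0, so its terms may dip below 0. The tolerance ¼ is small
      -- enough for log w, at least ½, to compensate.
      -¼≤log[1/ε] : Eventually (λ k → - ¼ ≤ seq E k)
      -¼≤log[1/ε] = eventually-map
        (λ k -E≤ → ≤-by ((nat 0 + ¼) - (nat 0 + - seq E k)) (lemma (seq E k)) (0≤q-p -E≤))
        (log₂-upper {ε} { -ᴿ E} log-ε 0 0
          (λ δ 0<δ → eventually-map (λ k → subst (_≤ 1ℚ + δ) (sym (ℚ.*-identityˡ (seq ε k)))) (ε≤1 δ 0<δ))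
          ¼ 0<¼)
        where
        lemma : ∀ x → x ≡ - ¼ + ((nat 0 + ¼) - (nat 0 + - x))
        lemma = solve-∀ ℚ-ring

      -- The overshoot of 3 is one unit for the shift that makes the sample nonnegative and an upper
      -- bound for later terms, one for rounding up, and one for the oscillation of the sequence.
      log[1/ε]-ceiling : ∃[ a ] Eventually (λ k → seq E k ≤ nat a × nat a ≤ seq E k + nat 3)
      log[1/ε]-ceiling = a , N , λ k N≤k →
          ℚ.≤-trans (∣p-q∣≤⇒p≤q+ (ℚ.<⇒≤ (near N≤k ℕ.≤-refl))) E+1≤a
        , ℚ.≤-trans a≤ (ℚ.≤-trans
            (ℚ.+-monoˡ-≤ 1ℚ (ℚ.+-monoˡ-≤ 1ℚ (∣p-q∣≤⇒p≤q+ {seq E N} (ℚ.<⇒≤ (near ℕ.≤-refl N≤k)))))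
            (ℚ.≤-reflexive (three (seq E k))))
        where
        near₁ = cauchy E 1ℚ (ℚ.positive⁻¹ 1ℚ)
        start : Eventually (λ k → proj₁ near₁ ℕ.≤ k × - ¼ ≤ seq E k)
        start = eventually-∧ (proj₁ near₁ , λ k N≤k → N≤k) -¼≤log[1/ε]
        N = proj₁ start
        near : ∀ {j k} → N ℕ.≤ j → N ℕ.≤ k → ∣ seq E j - seq E k ∣ < 1ℚ
        near N≤j N≤k = proj₂ near₁ _ _ (proj₁ (proj₂ start _ N≤j)) (proj₁ (proj₂ start _ N≤k))
        0≤E+1 : 0ℚ ≤ seq E N + 1ℚ
        0≤E+1 = ℚ.≤-trans (ℚ.nonNegative⁻¹ (- ¼ + 1ℚ)) (ℚ.+-monoˡ-≤ 1ℚ (proj₂ (proj₂ start N ℕ.≤-refl)))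
        a = proj₁ (ceiling (seq E N + 1ℚ) 0≤E+1)
        E+1≤a = proj₁ (proj₂ (ceiling (seq E N + 1ℚ) 0≤E+1))
        a≤ = proj₂ (proj₂ (ceiling (seq E N + 1ℚ) 0≤E+1))
        three : ∀ x → x + 1ℚ + 1ℚ + 1ℚ ≡ x + nat 3
        three = solve-∀ ℚ-ring

      private
        a = proj₁ log[1/ε]-ceiling
        -- An exponent with 2^B at least 1/λ = 32 w³/ε: `a` covers 1/ε, 5 covers the 32 and `h * 3`
        -- covers w³.
        B = a ℕ.+ (5 ℕ.+ h ℕ.* 3)

      1≤2^aε : ∀ δ → 0ℚ < δ → Eventually (λ k → 1ℚ ≤ nat (2 ℕ.^ a) * seq ε k + δ)
      1≤2^aε = log₂-lower⁻¹ {ε} { -ᴿ E} log-ε 0 a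
        (λ δ 0<δ → eventually-map
          (λ k (E≤a , _) → p+δ-mono 0<δ (0≤q-p E≤a)) (proj₂ log[1/ε]-ceiling))

      32w³≤ : 32 ℕ.* w ℕ.^ 3 ℕ.≤ 2 ℕ.^ (5 ℕ.+ h ℕ.* 3)
      32w³≤ = ℕ.≤-trans
        (ℕ.*-monoʳ-≤ 32 (ℕ.≤-trans (ℕ.^-monoˡ-≤ 3 (n≤2^⌈log₂n⌉ w)) (ℕ.≤-reflexive (ℕ.^-*-assoc 2 h 3))))
        (ℕ.≤-reflexive (sym (ℕ.^-distribˡ-+-* 2 5 (h ℕ.* 3))))

      1≤2^Bλ : ∀ δ → 0ℚ < δ → Eventually (λ k → 1ℚ ≤ nat (2 ℕ.^ B) * seq λ′ k + δ)
      1≤2^Bλ δ 0<δ = eventually-map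
        (λ k (1≤ , δ₀≤ε) → ℚ.≤-trans 1≤ (ℚ.+-monoˡ-≤ δ
          (subst (λ x → nat (2 ℕ.^ a) * seq ε k ≤ nat (2 ℕ.^ B) * x) (sym (seq-λ′ k)) (grow (seq ε k) (ℚ.≤-trans (ℚ.<⇒≤ (proj₁ (proj₂ positive-ε))) δ₀≤ε)))))
        (eventually-∧ (1≤2^aε δ 0<δ) (proj₂ (proj₂ positive-ε)))
        where
        positive-ε = eventually-positive {ε} 0<ε
        M = nat (2 ℕ.^ (5 ℕ.+ h ℕ.* 3))
        1≤σM : 1ℚ ≤ σ * M
        1≤σM = subst (_≤ σ * M) σ-inverse (*-monoˡ 0≤σ (nat-mono 32w³≤))
        grow : ∀ e → 0ℚ ≤ e → nat (2 ℕ.^ a) * e ≤ nat (2 ℕ.^ B) * (e * σ)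
        grow e 0≤e = begin
          A * e               ≡⟨ sym (ℚ.*-identityʳ (A * e)) ⟩
          A * e * 1ℚ          ≤⟨ *-monoˡ (*-nonneg (nat-nonneg (2 ℕ.^ a)) 0≤e) 1≤σM ⟩
          A * e * (σ * M)     ≡⟨ lemma A e σ M ⟩
          (A * M) * (e * σ)
            ≡⟨ cong (_* (e * σ)) (sym (trans (cong nat (ℕ.^-distribˡ-+-* 2 a (5 ℕ.+ h ℕ.* 3)))
                 (nat-* (2 ℕ.^ a) (2 ℕ.^ (5 ℕ.+ h ℕ.* 3))))) ⟩
          nat (2 ℕ.^ B) * (e * σ) ∎
          where
          open ℚ.≤-Reasoning
          A = nat (2 ℕ.^ a)
          lemma : ∀ A e s M → A * e * (s * M) ≡ (A * M) * (e * s)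
          lemma = solve-∀ ℚ-ring

      log[1/λ]≤64 : Eventually (λ k → seq ℓ k ≤ nat 64 * (seq E k + seq W k))
      log[1/λ]≤64 = eventually-map
        (λ k (((0≤B-ℓ , (_ , a≤E+3)) , -¼≤E) , (½≤W , h≤4W)) →
          bound (seq ℓ k) (seq E k) (seq W k) 0≤B-ℓ a≤E+3 -¼≤E ½≤W h≤4W)
        (eventually-∧ (eventually-∧ (eventually-∧
          (log₂-lower {λ′} { -ᴿ ℓ} log-λ 0 B 1≤2^Bλ ½ 0<½)
          (proj₂ log[1/ε]-ceiling)) -¼≤log[1/ε])
          (eventually-∧ (½≤log 2≤w {W} log-w) (⌈log₂⌉≤4log 2≤w {W} log-w)))
        where
        natB : nat B ≡ nat a + (nat 5 + nat h * nat 3)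
        natB = trans (nat-+ a (5 ℕ.+ h ℕ.* 3))
          (cong (nat a +_) (trans (nat-+ 5 (h ℕ.* 3)) (cong (nat 5 +_) (nat-* h 3))))
        isolate : ∀ ℓ B → B + ½ ≡ ℓ + ((B + - ℓ + ½) - nat 0)
        isolate = solve-∀ ℚ-ring
        -- The constant 8½ and the loss 63/4 from `E` being possibly as low as -¼ are paid by 52
        -- spare copies of `W`, worth at least 26; 7/4 is left over.
        surplus : ∀ E W → nat 64 * (E + W) ≡
          ((E + nat 3) + (nat 5 + (nat 4 * W) * nat 3) + ½)
            + (nat 63 * (E - - ¼) + (nat 52 * (W - ½) + ¼ * nat 7))
        surplus = solve-∀ ℚ-ring
        bound : ∀ ℓ E W → nat 0 ≤ nat B + - ℓ + ½ → nat a ≤ E + nat 3 → - ¼ ≤ E → ½ ≤ W →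
          nat h ≤ nat 4 * W → ℓ ≤ nat 64 * (E + W)
        bound ℓ E W 0≤ a≤ -¼≤E ½≤W h≤ = begin
          ℓ ≤⟨ ≤-by ((nat B + - ℓ + ½) - nat 0) (isolate ℓ (nat B)) (0≤q-p 0≤) ⟩
          nat B + ½ ≡⟨ cong (_+ ½) natB ⟩
          nat a + (nat 5 + nat h * nat 3) + ½
            ≤⟨ ℚ.+-monoˡ-≤ ½ (ℚ.+-mono-≤ a≤ (ℚ.+-monoʳ-≤ (nat 5) (*-monoʳ (nat-nonneg 3) h≤))) ⟩
          (E + nat 3) + (nat 5 + (nat 4 * W) * nat 3) + ½
            ≤⟨ ≤-by (nat 63 * (E - - ¼) + (nat 52 * (W - ½) + ¼ * nat 7)) (surplus E W)
                 (+-nonneg (*-nonneg (nat-nonneg 63) (0≤q-p -¼≤E))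
                   (+-nonneg (*-nonneg (nat-nonneg 52) (0≤q-p ½≤W))
                     (ℚ.nonNegative⁻¹ (¼ * nat 7)))) ⟩
          nat 64 * (E + W) ∎
          where open ℚ.≤-Reasoning

    module SeedLength {n d c : ℕ} (2≤n : 2 ℕ.≤ n) {N : ℝ} (log-n : IsLog₂ (fromℕ n) N)
      (d≤cℓ : fromℕ d ≤ᴿ fromℕ c *ᴿ ℓ) where

      private
        S = seedLength d ⌈log₂ n ⌉

        base : Eventually (λ k → (½ ≤ seq ℓ k × ½ ≤ seq N k)
                               × nat S ≤ nat (4 ℕ.* c ℕ.+ 8) * (seq ℓ k * seq N k))
        base = eventually-map
          (λ k ((½≤ℓ , d≤) , (½≤N , h≤)) →
            (½≤ℓ , ½≤N) , seedLength-bound {d} {c} {⌈log₂ n ⌉} ½≤ℓ ½≤N h≤ d≤)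
          (eventually-∧ (eventually-∧ ½≤log[1/λ] (d≤cℓ ½ 0<½))
                        (eventually-∧ (½≤log 2≤n {N} log-n) (⌈log₂⌉≤4log 2≤n {N} log-n)))

      seedLength≤log[1/λ]log : fromℕ S ≤ᴿ fromℕ (seedConstant c) *ᴿ (ℓ *ᴿ N)
      seedLength≤log[1/λ]log δ 0<δ = eventually-map
        (λ k ((½≤ℓ , ½≤N) , S≤) → p+δ-mono 0<δ
          (coarsen {c} {ℓ = seq ℓ k} {x = seq ℓ k} ½≤N S≤ (≤64* (ℚ.≤-trans 0≤½ ½≤ℓ)))) base
        where
        ≤64* : ∀ {x} → 0ℚ ≤ x → x ≤ nat 64 * x
        ≤64* {x} 0≤x = ≤-by (nat 63 * x) (lemma x) (*-nonneg (nat-nonneg 63) 0≤x)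
          where
          lemma : ∀ x → nat 64 * x ≡ x + nat 63 * x
          lemma = solve-∀ ℚ-ring

      seedLength≤[log[1/ε]+log]log : {E W : ℝ} → 2 ℕ.≤ w → IsLog₂[1/ ε ] E → IsLog₂ (fromℕ w) W →
        fromℕ S ≤ᴿ fromℕ (seedConstant c) *ᴿ ((E +ᴿ W) *ᴿ N)
      seedLength≤[log[1/ε]+log]log {E} {W} 2≤w log-ε log-w δ 0<δ = eventually-map
        (λ k (((_ , ½≤N) , S≤) , ℓ≤) → p+δ-mono 0<δ (coarsen {c} {ℓ = seq ℓ k} {x = seq E k + seq W k} ½≤N S≤ ℓ≤))
        (eventually-∧ base (log[1/λ]≤64 {E} {W} 2≤w log-ε log-w))

open import Data.Nat using (NonZero; _≤_; _<_)

theorem3p1 : ∀ (c : ℕ) → ∃[ C ]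
    ∀ (n w : ℕ) .{{_ : NonZero w}} (ε : ℝ) → 0ᴿ <ᴿ ε → ε ≤ᴿ 1ᴿ →
    ∀ (log1/λ : ℝ) → IsLog₂[1/ inwλ ε w ] log1/λ →
    ∀ (d : ℕ) → fromℕ d ≤ᴿ fromℕ c *ᴿ log1/λ → log1/λ ≤ᴿ fromℕ c *ᴿ fromℕ d →
    ∀ (H : ∀ i → RegularGraph (seedLength d i) d) →
    (∀ i → i < ⌈log₂ n ⌉ → IsExpander (inwλ ε w) (H i)) →
    IsPRG ε w n (seedLength d ⌈log₂ n ⌉) (INW n H)
    × (2 ≤ n →
    ∀ (logn : ℝ) → IsLog₂ (fromℕ n) logn →
    fromℕ (seedLength d ⌈log₂ n ⌉) ≤ᴿ fromℕ C *ᴿ (log1/λ *ᴿ logn)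
    × (2 ≤ w →
    ∀ (log1/ε logw : ℝ) → IsLog₂[1/ ε ] log1/ε → IsLog₂ (fromℕ w) logw →
    fromℕ (seedLength d ⌈log₂ n ⌉) ≤ᴿ fromℕ C *ᴿ ((log1/ε +ᴿ logw) *ᴿ logn)))
theorem3p1 c = seedConstant c , λ n w {{w≢0}} ε 0<ε ε≤1 ℓ log-λ d d≤cℓ _ H expander →
  INW-fools {n} {w} {d} {{w≢0}} {ε} 0<ε ε≤1 H expander , λ 2≤n logn log-n →
  Logs.SeedLength.seedLength≤log[1/λ]log
    {w} {{w≢0}} {ε} {inwλ ε w {{w≢0}}} {ℓ} 0<ε ε≤1 (Scale.seq-inwλ w {{w≢0}} ε) log-λ
    {n} {d} {c} 2≤n {logn} log-n d≤cℓ ,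
  λ 2≤w E W → Logs.SeedLength.seedLength≤[log[1/ε]+log]log
    {w} {{w≢0}} {ε} {inwλ ε w {{w≢0}}} {ℓ} 0<ε ε≤1 (Scale.seq-inwλ w {{w≢0}} ε) log-λ
    {n} {d} {c} 2≤n {logn} log-n d≤cℓ {E} {W} 2≤w
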